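{- Let $T$ be a trajectory string over an alphabet of size $\sigma$, $T_{bwt}$ its Burrows--Wheeler transform, $\phi$ a relative movement labeling (RML) function for $T$, and $b\ge 1$ an RRR block-size parameter. For all integers $k>0$, the total number of bits required to store $\phi(T_{bwt})$ in a Huffman-shaped wavelet tree with RRR bit vectors of parameter $b$, apart from the RRR-overhead, is at most $$|T|\,H_k(T)+O(l\sigma b),$$ where $l\le\sigma^k$ is the number of distinct contexts $W\in\Sigma^k$ in $T$.
   Context: Trajectory string: a network-constrained trajectory (NCT) on a directed graph $(V,E)$ is a (nonempty) sequence $e_1\cdots e_n$ of physically connected road segments $e_i\in E$. Given NCTs $T_1,\dots,T_N$, the trajectory string is $T=T_1^r\,\$\cdots T_N^r\,\$\,\#$, where $T_k^r$ is the reversal of $T_k$ and $\$,\#\notin E$ are special symbols. The alphabet is $\Sigma=E\cup\{\$,\#\}$, $\sigma=|\Sigma|$, totally ordered with $\#<\$<w$ for all $w\in E$. BWT: $T_{bwt}$ is the last column of the lexicographically sorted list of all cyclic rotations of $T$ (0-based positions). $C[w]$ is the number of symbols in $T$ strictly smaller than $w$, and $C[w+1]$ (with $w+1$ the successor of $w$) the number of symbols of $T$ that are $\le w$. RML: with $T$ read cyclically, $N_{out}(w')$ is the set of $w\in\Sigma$ such that $ww'$ occurs in $T$. An RML function assigns a label $\phi(w|w')\in\{1,\dots,\sigma\}$ to each $w'\in\Sigma$, $w\in N_{out}(w')$, with $\phi(\cdot|w')$ one-to-one for each $w'$. $\phi(T_{bwt})$ is the string whose $i$-th symbol is $\phi(T_{bwt}[i]|w')$,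 where $w'$ is the unique symbol with $C[w']\le i<C[w'+1]$. Entropy: $H_0(S)=\sum_x\frac{n_x}{n}\lg\frac{n}{n_x}$ for a string $S$ of length $n$ in which symbol $x$ occurs $n_x$ times ($\lg=\log_2$). With $n=|T|$, $$H_k(T)=\sum_{W\in\Sigma^k}\frac{n_W}{n}H_0(T_W),$$ where $n_W$ is the number of (cyclic) occurrences of $W$ in $T$ and $T_W$ is the concatenation of all symbols of $T$ that immediately precede an occurrence of the context $W$ (cyclically). Huffman-shaped wavelet tree (HWT) of a string $S$: the binary tree is the Huffman tree of the symbol frequencies of $S$. Each internal node $v$ stores a bit vector $B_v$ with one bit for each occurrence in $S$ of a symbol whose leaf lies below $v$, in the order of occurrence in $S$; the bit says whether that symbol's leaf is in the left (0) or right (1) subtree of $v$. RRR with parameter $b$: a bit vector $B$ is divided into consecutive blocks of length $b$ (the last one padded if necessary). Each block is represented by its class $c$ (its number of 1's) and its offset, an index among the $\binom{b}{c}$ layouts of 1's, requiring $\lg\binom{b}{c}$ bits. The classes take $|B|\,h(b)$ bits with $h(b)=\lg(b+1)/b$; this is the RRR-overhead, and the total RRR-overhead of the HWT is $\sum_v|B_v|h(b)$. Non-dominant auxiliary terms of the RRR structure are ignored, so the bits apart from the overhead are $\sum_v\sum_{\text{blocks of }B_v}\lg\binom{b}{c}$. The constant in $O(\cdot)$ is absolute. -}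

module Defs where

open import Data.Bool.Base using (Bool; true; false)
open import Data.Bool.Properties using () renaming (_≟_ to _≟ᵇ_)
open import Data.Fin.Base using (Fin; zero; suc; toℕ; fromℕ<)
open import Data.Fin.Properties using (_≟_; toℕ<n; toℕ-fromℕ<; ≤-decTotalOrder)
open import Data.List.Base as List
  using (List; []; _∷_; _++_; map; concatMap; filter; reverse; foldr;
         upTo; allFin; tabulate; zipWith; take; drop; replicate; deduplicate;
         cartesianProductWith)
open import Data.List.Membership.DecPropositional using (_∈?_)
open import Data.List.NonEmpty.Base using (List⁺; toList; length; _∷ʳ_)
open import Data.List.Properties using (filter-all)
open import Data.List.Relation.Binary.Permutation.Propositional using (_↭_)
open import Data.List.Relation.Unary.All as All using (All)
open import Data.List.Relation.Unary.Linked using (Linked)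
open import Data.List.Sort using (sort)
open import Data.Nat.Base
open import Data.Nat.Combinatorics using (_C_)
open import Data.Nat.DivMod using (_/_; _mod_)
open import Data.Nat.ListAction using (sum)
open import Data.Nat.Properties
  using (_<?_; ≮⇒≥; ≤-refl; <⇒≤; m*n≢0; m^n≢0)
open import Data.Product.Base using (∃-syntax; Σ-syntax; _×_; _,_; proj₁; proj₂)
open import Data.Vec.Base as Vec using (Vec)
open import Data.Vec.Properties using (≡-dec)
open import Data.Vec.Relation.Binary.Lex.NonStrict
  using () renaming (≤-decTotalOrder to lex-decTotalOrder)
open import Relation.Binary.Definitions using (DecidableEquality)
open import Relation.Binary.PropositionalEquality.Core using (_≡_; refl; sym; cong; subst)
open import Relation.Nullary.Decidable using (yes; no; does)

private
  variable
    A : Set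
    σ : ℕ

------------------------------------------------------------------------
-- Logarithms

-- The standard library has no real numbers.  Every quantity below (binary
-- logarithms of positive rationals, their sums, their multiples by
-- nonnegative rationals, natural numbers) lies in the ordered subgroup
--
--   { (lg (p/q)) / d  |  p , q , d positive integers }   of  (ℝ , + , ≤),
--
-- whose elements are represented here by triples (p , q , d).  Since lg
-- is strictly increasing, the order of ℝ between two of them is an inequality
-- between natural numbers.

record LogReal : Set where
  constructor mkLog
  field
    num den root : ℕ
    .{{num≢0}}   : NonZero num
    .{{den≢0}}   : NonZero den
    .{{root≢0}}  : NonZero root

-- (lg (p/q)) / d + (lg (p′/q′)) / d′ = (lg (p^d′ p′^d / q^d′ q′^d)) / (d d′)

infixl 6 _+ᴸ_
_+ᴸ_ : LogReal → LogReal → LogReal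
mkLog p q d +ᴸ mkLog p′ q′ d′ =
  mkLog (p ^ d′ * p′ ^ d) (q ^ d′ * q′ ^ d) (d * d′)
    {{m*n≢0 _ _ {{m^n≢0 p d′}} {{m^n≢0 p′ d}}}}
    {{m*n≢0 _ _ {{m^n≢0 q d′}} {{m^n≢0 q′ d}}}}
    {{m*n≢0 d d′}}

-- (lg (p/q)) / d ≤ (lg (p′/q′)) / d′  iff  (p/q)^d′ ≤ (p′/q′)^d

infix 4 _≤ᴸ_
_≤ᴸ_ : LogReal → LogReal → Set
mkLog p q d ≤ᴸ mkLog p′ q′ d′ = p ^ d′ * q′ ^ d ≤ p′ ^ d * q ^ d′

-- [ m / n ]· x  is the product of x by the rational number m/n.

infixr 7 [_/_]·_
[_/_]·_ : ℕ → (n : ℕ) .{{_ : NonZero n}} → LogReal → LogReal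
[ m / n ]· mkLog p q d =
  mkLog (p ^ m) (q ^ m) (n * d) {{m^n≢0 p m}} {{m^n≢0 q m}} {{m*n≢0 n d}}

-- m = lg (2^m)

fromℕ : ℕ → LogReal
fromℕ m = mkLog (2 ^ m) 1 1 {{m^n≢0 2 m}}

-- lg[ m / n ] is the binary logarithm of m/n; it is totalised by 0 when m
-- or n is 0, which makes 0 · lg (n/0) = 0 in the entropy.

lg[_/_] : ℕ → ℕ → LogReal
lg[ suc m / suc n ] = mkLog (suc m) (suc n) 1
lg[ _     / _     ] = fromℕ 0

lg : ℕ → LogReal
lg n = lg[ n / 1 ]

sumᴸ : List LogReal → LogReal
sumᴸ = foldr _+ᴸ_ (fromℕ 0)

------------------------------------------------------------------------
-- Trajectory strings

-- Edges are abstract, so parallel edges are allowed.  Any total order on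
-- the edges is obtained through a suitable numbering.

record DirectedGraph : Set where
  field
    ∣V∣ ∣E∣       : ℕ
    source target : Fin ∣E∣ → Fin ∣V∣

open DirectedGraph public

record NCT (G : DirectedGraph) : Set where
  field
    segments  : List⁺ (Fin (∣E∣ G))
    connected : Linked (λ e f → target G e ≡ source G f) (toList segments)

open NCT public

alphabetSize : DirectedGraph → ℕ
alphabetSize G = 2 + ∣E∣ G

Symbol : DirectedGraph → Set
Symbol G = Fin (alphabetSize G)

-- With the order of Fin, # < $ < w for every edge w.

pattern #      = zero
pattern $      = suc zero
pattern edge e = suc (suc e)

trajectoryString : {G : DirectedGraph} → List⁺ (NCT G) → List⁺ (Symbol G)
trajectoryString Ts =
  concatMap (λ t → map edge (reverse (toList (segments t))) ++ $ ∷ []) (toList Ts) ∷ʳ #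

------------------------------------------------------------------------
-- Cyclic strings and the Burrows–Wheeler transform

infix 9 _⟨_⟩
_⟨_⟩ : List⁺ A → ℕ → A
T ⟨ i ⟩ = List.lookup (toList T) (i mod length T)

window : List⁺ A → (k : ℕ) → ℕ → Vec A k
window T k i = Vec.tabulate (λ j → T ⟨ i + toℕ j ⟩)

rotations : (T : List⁺ A) → List (Vec A (length T))
rotations T = map (window T (length T)) (upTo (length T))

bwt : List⁺ (Fin σ) → List (Fin σ)
bwt {σ} T = map Vec.last (sort (lex-decTotalOrder (≤-decTotalOrder σ) (length T)) (rotations T))

-- C[ T ] j is the number of symbols of T smaller than the j-th symbol of
-- the alphabet; hence C[ T ] (suc j) is the number of those that are at
-- most the j-th one.

C[_] : List⁺ (Fin σ) → ℕ → ℕ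
C[ T ] j = List.length (filter (λ x → toℕ x <? j) (toList T))

-- The symbol w′ with C[w′] ≤ i < C[w′+1].

rowSymbol : (T : List⁺ (Fin σ)) (i : Fin (length T)) →
            Σ[ w′ ∈ Fin σ ] C[ T ] (toℕ w′) ≤ toℕ i × toℕ i < C[ T ] (suc (toℕ w′))
rowSymbol {σ} T i = search σ (≤-refl) i<C[σ]
  where
  C[σ]≡∣T∣ : C[ T ] σ ≡ length T
  C[σ]≡∣T∣ = cong List.length (filter-all (λ x → toℕ x <? σ) (All.universal toℕ<n (toList T)))

  i<C[σ] : toℕ i < C[ T ] σ
  i<C[σ] = subst (toℕ i <_) (sym C[σ]≡∣T∣) (toℕ<n i)

  C[0]≡0 : ∀ xs → List.length (filter (λ (x : Fin σ) → toℕ x <? 0) xs) ≡ 0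
  C[0]≡0 []       = refl
  C[0]≡0 (_ ∷ xs) = C[0]≡0 xs

  search : ∀ j → j ≤ σ → toℕ i < C[ T ] j →
           Σ[ w′ ∈ Fin σ ] C[ T ] (toℕ w′) ≤ toℕ i × toℕ i < C[ T ] (suc (toℕ w′))
  search zero    _   i<C with () ← subst (toℕ i <_) (C[0]≡0 (toList T)) i<C
  search (suc j) j<σ i<C with toℕ i <? C[ T ] j
  ... | yes i<C[j] = search j (<⇒≤ j<σ) i<C[j]
  ... | no  i≮C[j] = fromℕ< j<σ ,
    subst (λ x → C[ T ] x ≤ toℕ i × toℕ i < C[ T ] (suc x))
          (sym (toℕ-fromℕ< j<σ)) (≮⇒≥ i≮C[j] , i<C)

------------------------------------------------------------------------
-- Relative movement labeling

_∈N-out[_]_ : Fin σ → List⁺ (Fin σ) → Fin σ → Set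
w ∈N-out[ T ] w′ = ∃[ i ] T ⟨ i ⟩ ≡ w × T ⟨ suc i ⟩ ≡ w′

-- The element j of Fin σ stands for the label j + 1.  label w w′ is
-- φ(w|w′); its values for w outside N_out(w′) are irrelevant.

record RML (T : List⁺ (Fin σ)) : Set where
  field
    label     : Fin σ → Fin σ → Fin σ
    injective : ∀ {w′ w₁ w₂} → w₁ ∈N-out[ T ] w′ → w₂ ∈N-out[ T ] w′ →
                label w₁ w′ ≡ label w₂ w′ → w₁ ≡ w₂

open RML public

labelledBWT : (T : List⁺ (Fin σ)) → RML T → List (Fin σ)
labelledBWT T φ = zipWith (label φ) (bwt T) (tabulate (λ i → proj₁ (rowSymbol T i)))

------------------------------------------------------------------------
-- Empirical entropy

count : Fin σ → List (Fin σ) → ℕ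
count x S = List.length (filter (x ≟_) S)

H₀ : List (Fin σ) → LogReal
H₀ []          = fromℕ 0
H₀ {σ} S@(_ ∷ xs) =
  sumᴸ (map (λ x → [ count x S / n ]· lg[ n / count x S ]) (allFin σ))
  where n = suc (List.length xs)

words : (σ k : ℕ) → List (Vec (Fin σ) k)
words σ zero    = Vec.[] ∷ []
words σ (suc k) = cartesianProductWith Vec._∷_ (allFin σ) (words σ k)

occurrences : ∀ {k} → List⁺ (Fin σ) → Vec (Fin σ) k → List ℕ
occurrences {k = k} T W = filter (λ i → ≡-dec _≟_ (window T k i) W) (upTo (length T))

#occurrences : ∀ {k} → List⁺ (Fin σ) → Vec (Fin σ) k → ℕ
#occurrences T W = List.length (occurrences T W)

-- The symbol cyclically preceding position i is at i + (|T| − 1).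

preceding : ∀ {k} → List⁺ (Fin σ) → Vec (Fin σ) k → List (Fin σ)
preceding T W = map (λ i → T ⟨ i + pred (length T) ⟩) (occurrences T W)

H : ℕ → List⁺ (Fin σ) → LogReal
H {σ} k T =
  sumᴸ (map (λ W → [ #occurrences T W / length T ]· H₀ (preceding T W)) (words σ k))

#contexts : ℕ → List⁺ (Fin σ) → ℕ
#contexts {σ} k T = List.length (filter (λ W → 0 <? #occurrences T W) (words σ k))

------------------------------------------------------------------------
-- Huffman-shaped wavelet trees

data Tree (A : Set) : Set where
  leaf : A → Tree A
  node : Tree A → Tree A → Tree A

leaves : Tree A → List A
leaves (leaf x)   = x ∷ []
leaves (node l r) = leaves l ++ leaves r

weight : List (Fin σ) → Tree (Fin σ) → ℕ
weight S t = sum (map (λ x → count x S) (leaves t))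

-- Huffman's algorithm run from a forest: repeatedly replace two trees of
-- least weight by a node having them as children, with arbitrary choice of
-- the order of the children and arbitrary breaking of ties.

data Merges (S : List (Fin σ)) : List (Tree (Fin σ)) → Tree (Fin σ) → Set where
  done  : ∀ {t} → Merges S (t ∷ []) t
  merge : ∀ {forest l r rest t} →
          forest ↭ l ∷ r ∷ rest →
          All (λ u → weight S l ≤ weight S u × weight S r ≤ weight S u) rest →
          Merges S (node l r ∷ rest) t →
          Merges S forest t

IsHuffmanTree : List (Fin σ) → Tree (Fin σ) → Set
IsHuffmanTree S = Merges S (map leaf (deduplicate _≟_ S))

-- The bit vector of the node with children l and r; true is the bit 1.

bitVector : List (Fin σ) → Tree (Fin σ) → Tree (Fin σ) → List Bool
bitVector S l r =
  map (λ x → does (_∈?_ _≟_ x (leaves r))) (filter (λ x → _∈?_ _≟_ x (leaves (node l r))) S)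

bitVectors : List (Fin σ) → Tree (Fin σ) → List (List Bool)
bitVectors S (leaf _)   = []
bitVectors S (node l r) = bitVector S l r ∷ bitVectors S l ++ bitVectors S r

------------------------------------------------------------------------
-- RRR

-- The ⌈ |B| / b ⌉ consecutive blocks of length b, the last one padded by
-- zeros.

blocks : (b : ℕ) .{{_ : NonZero b}} → List Bool → List (List Bool)
blocks b B =
  map (λ j → take b (drop (j * b) (B ++ replicate b false)))
      (upTo ((List.length B + pred b) / b))

class : List Bool → ℕ
class block = List.length (filter (true ≟ᵇ_) block)

rrrBits : (b : ℕ) .{{_ : NonZero b}} → List Bool → LogReal
rrrBits b B = sumᴸ (map (λ block → lg (b C class block)) (blocks b B))

-- Size without the RRR-overhead.

hwtBits : (b : ℕ) .{{_ : NonZero b}} → List (Fin σ) → Tree (Fin σ) → LogReal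
hwtBits b S t = sumᴸ (map (rrrBits b) (bitVectors S t))

{-# OPTIONS --safe #-}

-- The rotations that start with a given context W are contiguous in the sorted list, so φ(T_bwt)
-- is the concatenation over W of pieces, and as φ(·|w′) is one-to-one, the piece of W has the
-- symbol counts of T_W up to renaming.  At a node v of the wavelet tree, B_v is the concatenation
-- of the bit vectors of the pieces.  A block inside one piece is paid by
-- C(m, i) C(n, j) ≤ C(m + n, i + j), and each nonempty piece is charged b further bits for the
-- block in which it ends: b l bits for each of the at most σ nodes.  What is left for a piece are
-- the binomial coefficients C(|B_v|, #1 in B_v), whose product over v is a multinomial
-- coefficient, at most N^N / ∏ c_x^{c_x}, the exponential of the entropy term.
-- Only the leaves of the Huffman tree matter: they are the symbols of the string, each once.

module Submission where

open import Defs
open import Data.Bool.Base using (Bool; true; false)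
open import Data.Bool.Properties using () renaming (_≟_ to _≟ᵇ_)
open import Data.Empty using (⊥)
open import Data.Fin.Base as Fin using (Fin; zero; suc; toℕ)
open import Data.Fin.Properties as Fin
  using (_≟_; toℕ<n; toℕ-fromℕ<; toℕ-injective; toℕ-fromℕ; ≤-decTotalOrder; injective⇒≤)
open import Data.List.Base as List
  using (List; []; _∷_; _++_; map; concat; concatMap; filter; allFin; take; drop; replicate; upTo;
         applyUpTo; zipWith; tabulate; lookup; cartesianProductWith; deduplicate)
open import Data.List.Membership.DecPropositional using (_∈?_)
open import Data.List.Membership.Propositional using (_∈_)
open import Data.List.Membership.Propositional.Properties
  using (∈-++⁺ˡ; ∈-++⁺ʳ; ∈-++⁻; ∈-allFin; ∈-map⁻; ∈-filter⁻; ∈-lookup;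
         ∈-cartesianProductWith⁺; ∈-deduplicate⁺)
open import Data.List.NonEmpty.Base as List⁺ using (List⁺; length; toList)
open import Data.List.Properties
  using (filter-++; filter-all; filter-none; filter-reject; filter-≐; length-++; length-filter;
         length-map; length-drop; length-take; length-tabulate; map-++; map-cong; map-cong-local;
         map-∘; map-upTo; map-applyUpTo; take++drop≡id; drop-drop; drop-all;
         concat-map; concatMap-map; concatMap-pure; ++-assoc; ++-identityʳ)
open import Data.List.Relation.Binary.Disjoint.Propositional using (Disjoint)
open import Data.List.Relation.Binary.Permutation.Propositional as ↭
  using (_↭_; ↭-refl; ↭-sym; ↭-trans; ↭-reflexive; ↭⇒↭ₛ)
open import Data.List.Relation.Binary.Permutation.Propositional.Properties
  using (filter-↭; ↭-length; ∈-resp-↭; shifts; ++⁺ˡ)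
  renaming (map⁺ to ↭-map⁺)
import Data.List.Relation.Binary.Permutation.Setoid.Properties as Permutation
open import Data.List.Relation.Unary.All as All using (All; []; _∷_)
import Data.List.Relation.Unary.All.Properties as All
open import Data.List.Relation.Unary.AllPairs as AllPairs using (AllPairs; []; _∷_)
import Data.List.Relation.Unary.AllPairs.Properties as AllPairs
open import Data.List.Relation.Unary.Any using (here; there)
open import Data.List.Relation.Unary.Sorted.TotalOrder.Properties using (Sorted⇒AllPairs)
open import Data.List.Relation.Unary.Unique.DecPropositional.Properties using (deduplicate-!)
open import Data.List.Relation.Unary.Unique.Propositional using (Unique)
open import Data.List.Relation.Unary.Unique.Propositional.Properties using (allFin⁺)
open import Data.List.Sort using (sort; sort-↭; sort-↗)
open import Data.Nat.Base
open import Data.Nat.Combinatorics using (_C_; nCk+nC[k+1]≡[n+1]C[k+1]; nCn≡1)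
open import Data.Nat.DivMod
  using (_/_; _%_; _mod_; m<n⇒m/n≡0; m/n≡1+[m∸n]/n; m%n<n; m<n⇒m%n≡m; m%n%n≡m%n; [m+n]%n≡m%n;
         %-distribˡ-+)
open import Data.Nat.ListAction using (product)
open import Data.Nat.ListAction.Properties using (product-++; product-↭; product≢0)
open import Data.Nat.Properties hiding (_≟_; ≤-decTotalOrder)
open import Data.Nat.Tactic.RingSolver using (solve-∀)
open import Data.Product.Base using (∃-syntax; _×_; _,_; proj₁; proj₂)
open import Data.Sum.Base as Sum using (_⊎_; inj₁; inj₂; [_,_]′)
open import Data.Unit.Base using (tt)
open import Data.Vec.Base as Vec using (Vec; []; _∷_)
open import Data.Vec.Properties using (≡-dec; lookup∘tabulate; tabulate-cong)
open import Data.Vec.Relation.Binary.Lex.NonStrict as Lex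
  using (Lex-≤; Lex-<; base; this; next)
  renaming (≤-decTotalOrder to lex-decTotalOrder)
import Data.Vec.Relation.Binary.Pointwise.Inductive as Pointwise
open import Function.Base using (_∘_; id)
open import Relation.Binary.Bundles using (module DecTotalOrder)
open import Relation.Binary.Definitions using (DecidableEquality)
open import Relation.Binary.PropositionalEquality
open import Relation.Nullary using (¬_; yes; no; does; ¬?)
open import Relation.Nullary.Negation using (contradiction)
open import Relation.Unary using (Decidable; _⊆_)

open LogReal

private
  variable
    A B : Set
    σ : ℕ


-- Binomial coefficients

nC[1+k]≤[1+n]C[1+k] : ∀ n k → n C suc k ≤ suc n C suc k
nC[1+k]≤[1+n]C[1+k] n k = subst (n C suc k ≤_) (nCk+nC[k+1]≡[n+1]C[k+1] n k) (m≤n+m _ _)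

nCk≤[1+n]Ck : ∀ n k → n C k ≤ suc n C k
nCk≤[1+n]Ck n zero    = ≤-refl
nCk≤[1+n]Ck n (suc k) = nC[1+k]≤[1+n]C[1+k] n k

nCk≤[1+n]C[1+k] : ∀ n k → n C k ≤ suc n C suc k
nCk≤[1+n]C[1+k] n k = subst (n C k ≤_) (nCk+nC[k+1]≡[n+1]C[k+1] n k) (m≤m+n _ _)

nCk≤[m+n]Ck : ∀ m n k → n C k ≤ (m + n) C k
nCk≤[m+n]Ck zero    n k = ≤-refl
nCk≤[m+n]Ck (suc m) n k = ≤-trans (nCk≤[m+n]Ck m n k) (nCk≤[1+n]Ck (m + n) k)

nCk>0 : ∀ {n k} → k ≤ n → 1 ≤ n C k
nCk>0 z≤n       = ≤-refl
nCk>0 (s≤s {k} {n} k≤n) = ≤-trans (nCk>0 k≤n) (nCk≤[1+n]C[1+k] n k)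

-- A single term of Vandermonde's sum. Pascal's rule on both sides carries the induction on `m`.
mCj*nCk≤[m+n]C[j+k] : ∀ m n j k → (m C j) * (n C k) ≤ (m + n) C (j + k)
mCj*nCk≤[m+n]C[j+k] zero    n zero    k = ≤-reflexive (*-identityˡ (n C k))
mCj*nCk≤[m+n]C[j+k] zero    n (suc j) k = z≤n
mCj*nCk≤[m+n]C[j+k] (suc m) n zero    k =
  subst (_≤ (suc m + n) C k) (sym (*-identityˡ (n C k))) (nCk≤[m+n]Ck (suc m) n k)
mCj*nCk≤[m+n]C[j+k] (suc m) n (suc j) k = begin
  (suc m C suc j) * (n C k)
    ≡⟨ cong (_* (n C k)) (nCk+nC[k+1]≡[n+1]C[k+1] m j) ⟨
  (m C j + m C suc j) * (n C k)
    ≡⟨ *-distribʳ-+ (n C k) (m C j) _ ⟩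
  (m C j) * (n C k) + (m C suc j) * (n C k)
    ≤⟨ +-mono-≤ (mCj*nCk≤[m+n]C[j+k] m n j k) (mCj*nCk≤[m+n]C[j+k] m n (suc j) k) ⟩
  (m + n) C (j + k) + (m + n) C suc (j + k)
    ≡⟨ nCk+nC[k+1]≡[n+1]C[k+1] (m + n) (j + k) ⟩
  suc (m + n) C suc (j + k) ∎
  where open ≤-Reasoning

-- A single term of the binomial theorem. Pascal's rule splits the coefficient; a factor `x` is
-- taken out of one part and a factor `y` out of the other.
[m+n]Cm*xᵐ*yⁿ≤[x+y]ᵐ⁺ⁿ : ∀ m n x y → ((m + n) C m) * (x ^ m * y ^ n) ≤ (x + y) ^ (m + n)
[m+n]Cm*xᵐ*yⁿ≤[x+y]ᵐ⁺ⁿ zero n x y = begin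
  1 * (1 * y ^ n) ≡⟨ trans (*-identityˡ _) (*-identityˡ _) ⟩
  y ^ n           ≤⟨ ^-monoˡ-≤ n (m≤n+m y x) ⟩
  (x + y) ^ n     ∎
  where open ≤-Reasoning
[m+n]Cm*xᵐ*yⁿ≤[x+y]ᵐ⁺ⁿ (suc m) zero x y rewrite +-identityʳ m = begin
  (suc m C suc m) * (x ^ suc m * 1) ≡⟨ cong₂ _*_ (nCn≡1 (suc m)) (*-identityʳ (x ^ suc m)) ⟩
  1 * x ^ suc m                     ≡⟨ *-identityˡ _ ⟩
  x ^ suc m                         ≤⟨ ^-monoˡ-≤ (suc m) (m≤m+n x y) ⟩
  (x + y) ^ suc m                   ∎
  where open ≤-Reasoning
[m+n]Cm*xᵐ*yⁿ≤[x+y]ᵐ⁺ⁿ (suc m) (suc n) x y = begin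
  (suc (m + suc n) C suc m) * (x * X * (y * Y))
    ≡⟨ cong (_* (x * X * (y * Y))) (nCk+nC[k+1]≡[n+1]C[k+1] (m + suc n) m) ⟨
  ((m + suc n) C m + (m + suc n) C suc m) * (x * X * (y * Y))
    ≡⟨ rearrange ((m + suc n) C m) ((m + suc n) C suc m) x y X Y ⟩
  x * (((m + suc n) C m) * (X * (y * Y))) + y * (((m + suc n) C suc m) * (x * X * Y))
    ≤⟨ +-mono-≤ (*-monoʳ-≤ x ([m+n]Cm*xᵐ*yⁿ≤[x+y]ᵐ⁺ⁿ m (suc n) x y)) (*-monoʳ-≤ y rec) ⟩
  x * (x + y) ^ (m + suc n) + y * (x + y) ^ (m + suc n)
    ≡⟨ *-distribʳ-+ _ x y ⟨
  (x + y) * (x + y) ^ (m + suc n) ∎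
  where
  open ≤-Reasoning
  X = x ^ m
  Y = y ^ n
  rearrange : ∀ a b x y X Y → (a + b) * (x * X * (y * Y)) ≡ x * (a * (X * (y * Y))) + y * (b * (x * X * Y))
  rearrange = solve-∀
  rec : ((m + suc n) C suc m) * (x * X * Y) ≤ (x + y) ^ (m + suc n)
  rec = subst (λ s → (s C suc m) * (x * X * Y) ≤ (x + y) ^ s) (sym (+-suc m n))
          ([m+n]Cm*xᵐ*yⁿ≤[x+y]ᵐ⁺ⁿ (suc m) n x y)

nCk≤2ⁿ : ∀ {n k} → k ≤ n → n C k ≤ 2 ^ n
nCk≤2ⁿ {n} {k} k≤n = begin
  n C k
    ≡⟨ cong (_C k) n≡ ⟨
  (k + (n ∸ k)) C k
    ≡⟨ *-identityʳ _ ⟨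
  ((k + (n ∸ k)) C k) * 1
    ≡⟨ cong (((k + (n ∸ k)) C k) *_) (cong₂ _*_ (^-zeroˡ k) (^-zeroˡ (n ∸ k))) ⟨
  ((k + (n ∸ k)) C k) * (1 ^ k * 1 ^ (n ∸ k))
    ≤⟨ [m+n]Cm*xᵐ*yⁿ≤[x+y]ᵐ⁺ⁿ k (n ∸ k) 1 1 ⟩
  2 ^ (k + (n ∸ k))
    ≡⟨ cong (2 ^_) n≡ ⟩
  2 ^ n ∎
  where
  open ≤-Reasoning
  n≡ = m+[n∸m]≡n k≤n

-- RRR blocks of a concatenation

take-++ : ∀ r (xs ys : List A) → take r (xs ++ ys) ≡ take r xs ++ take (r ∸ List.length xs) ys
take-++ zero    []       ys = refl
take-++ zero    (x ∷ xs) ys = refl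
take-++ (suc r) []       ys = refl
take-++ (suc r) (x ∷ xs) ys = cong (x ∷_) (take-++ r xs ys)

drop-++ : ∀ r (xs ys : List A) → drop r (xs ++ ys) ≡ drop r xs ++ drop (r ∸ List.length xs) ys
drop-++ zero    []       ys = refl
drop-++ zero    (x ∷ xs) ys = refl
drop-++ (suc r) []       ys = refl
drop-++ (suc r) (x ∷ xs) ys = drop-++ r xs ys

take-++-≤ : ∀ {r} (xs ys : List A) → r ≤ List.length xs → take r (xs ++ ys) ≡ take r xs
take-++-≤ {r = r} xs ys r≤ = begin
  take r (xs ++ ys)                         ≡⟨ take-++ r xs ys ⟩
  take r xs ++ take (r ∸ List.length xs) ys ≡⟨ cong (λ s → take r xs ++ take s ys) (m≤n⇒m∸n≡0 r≤) ⟩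
  take r xs ++ []                           ≡⟨ ++-identityʳ _ ⟩
  take r xs                                 ∎
  where open ≡-Reasoning

drop-++-≤ : ∀ {r} (xs ys : List A) → r ≤ List.length xs → drop r (xs ++ ys) ≡ drop r xs ++ ys
drop-++-≤ {r = r} xs ys r≤ =
  trans (drop-++ r xs ys) (cong (λ s → drop r xs ++ drop s ys) (m≤n⇒m∸n≡0 r≤))

module _ (b : ℕ) .{{_ : NonZero b}} where

  private
    padding : List Bool
    padding = replicate b false

    pred[b]<b : pred b < b
    pred[b]<b = ≤-reflexive (suc-pred b)

    blockCount : ℕ → ℕ
    blockCount n = (n + pred b) / b

    -- Adding `pred b` rounds the division up. After a last, possibly partial block the truncated
    -- subtraction leaves length 0, which has no block.
    blockCount-suc : ∀ n → blockCount (suc n) ≡ suc (blockCount (suc n ∸ b))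
    blockCount-suc n = trans (m/n≡1+[m∸n]/n b≤) (cong suc remaining)
      where
      b≤ : b ≤ suc n + pred b
      b≤ = subst (_≤ suc n + pred b) (suc-pred b) (s≤s (m≤n+m (pred b) n))

      remaining : (suc n + pred b ∸ b) / b ≡ blockCount (suc n ∸ b)
      remaining with ≤-total b (suc n)
      ... | inj₁ b≤1+n = cong (_/ b) (+-∸-comm (pred b) b≤1+n)
      ... | inj₂ 1+n≤b = trans (m<n⇒m/n≡0 short)
        (sym (trans (cong blockCount (m≤n⇒m∸n≡0 1+n≤b)) (m<n⇒m/n≡0 pred[b]<b)))
        where
        short : suc n + pred b ∸ b < b
        short = subst (λ c → suc n + pred b ∸ c < b) (suc-pred b)
          (subst (_< b) (sym (m+n∸n≡m n (pred b))) 1+n≤b)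

  blocks-[] : blocks b [] ≡ []
  blocks-[] = cong (λ c → map (λ j → take b (drop (j * b) padding)) (upTo c)) (m<n⇒m/n≡0 pred[b]<b)

  -- Replaces indexing by the block number with recursion on the bits, the form in which blocks can
  -- be charged to pieces one at a time.
  blocks-∷ : ∀ x B → blocks b (x ∷ B) ≡ take b (x ∷ B ++ padding) ∷ blocks b (drop b (x ∷ B))
  blocks-∷ x B = begin
    map block (upTo (blockCount (suc (List.length B))))
      ≡⟨ cong (map block ∘ upTo) (blockCount-suc (List.length B)) ⟩
    block 0 ∷ map block (applyUpTo suc rest)
      ≡⟨ cong (block 0 ∷_) (trans (map-applyUpTo suc block rest) (sym (map-upTo (block ∘ suc) rest))) ⟩
    block 0 ∷ map (block ∘ suc) (upTo rest)
      ≡⟨ cong (block 0 ∷_) tail-blocks ⟩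
    block 0 ∷ blocks b (drop b (x ∷ B)) ∎
    where
    open ≡-Reasoning
    block : ℕ → List Bool
    block j = take b (drop (j * b) (x ∷ B ++ padding))
    rest = blockCount (suc (List.length B) ∸ b)

    tail-blocks : map (block ∘ suc) (upTo rest) ≡ blocks b (drop b (x ∷ B))
    tail-blocks with ≤-total b (suc (List.length B))
    ... | inj₁ b≤ = trans
      (map-cong (λ j → cong (take b) (trans (sym (drop-drop b (j * b) (x ∷ B ++ padding)))
                                            (cong (drop (j * b)) (drop-++-≤ (x ∷ B) padding b≤)))) (upTo rest))
      (cong (λ c → map (λ j → take b (drop (j * b) (drop b (x ∷ B) ++ padding))) (upTo (blockCount c)))
            (sym (length-drop b (x ∷ B))))
    -- The first block exhausts the bits, so neither side has a further block.
    ... | inj₂ ≤b = trans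
      (cong (map (block ∘ suc) ∘ upTo) (trans (cong blockCount (m≤n⇒m∸n≡0 ≤b)) (m<n⇒m/n≡0 pred[b]<b)))
      (sym (trans (cong (blocks b) (drop-all b (x ∷ B) ≤b)) blocks-[]))

-- Layout counts and the charge of a piece

class-++ : ∀ xs ys → class (xs ++ ys) ≡ class xs + class ys
class-++ xs ys = trans (cong List.length (filter-++ (true ≟ᵇ_) xs ys)) (length-++ (filter (true ≟ᵇ_) xs))

class≤length : ∀ xs → class xs ≤ List.length xs
class≤length = length-filter (true ≟ᵇ_)

-- The number of possible offsets if `p` were a single block of its own length.
layouts : List Bool → ℕ
layouts p = List.length p C class p

layouts>0 : ∀ p → 1 ≤ layouts p
layouts>0 p = nCk>0 (class≤length p)

layouts-++ : ∀ p q → layouts p * layouts q ≤ layouts (p ++ q)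
layouts-++ p q = subst₂ (λ m j → layouts p * layouts q ≤ m C j)
  (sym (length-++ p)) (sym (class-++ p q))
  (mCj*nCk≤[m+n]C[j+k] (List.length p) (List.length q) (class p) (class q))

-- The dropped prefix has at least one layout, so its factor in `layouts-++` can be discarded.
layouts-drop : ∀ r p → layouts (drop r p) ≤ layouts p
layouts-drop r p = begin
  layouts (drop r p)                      ≤⟨ m≤n*m _ _ {{>-nonZero (layouts>0 (take r p))}} ⟩
  layouts (take r p) * layouts (drop r p) ≤⟨ layouts-++ (take r p) (drop r p) ⟩
  layouts (take r p ++ drop r p)          ≡⟨ cong layouts (take++drop≡id r p) ⟩
  layouts p                               ∎
  where open ≤-Reasoning

module _ (b : ℕ) where

  -- 2 ^ b pays for the block in which a nonempty piece ends.
  slack : List A → ℕ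
  slack []      = 1
  slack (_ ∷ _) = 2 ^ b

  slack-drop : ∀ r (p : List A) → slack (drop r p) ≤ slack p
  slack-drop zero    p       = ≤-refl
  slack-drop (suc r) []      = ≤-refl
  slack-drop (suc r) (x ∷ p) = ≤-trans (slack-drop r p) (bound p)
    where
    bound : (p : List A) → slack p ≤ 2 ^ b
    bound []      = m^n>0 2 b
    bound (_ ∷ _) = ≤-refl

  pay : List Bool → ℕ
  pay p = layouts p * slack p

  pay-drop : ∀ r p → pay (drop r p) ≤ pay p
  pay-drop r p = *-mono-≤ (layouts-drop r p) (slack-drop r p)

-- Cuts `r` entries off the concatenation but keeps the division into pieces; exhausted pieces stay
-- in the list as empty ones.
dropPieces : ℕ → List (List A) → List (List A)
dropPieces r []       = []
dropPieces r (p ∷ ps) = drop r p ∷ dropPieces (r ∸ List.length p) ps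

concat-dropPieces : ∀ r (ps : List (List A)) → concat (dropPieces r ps) ≡ drop r (concat ps)
concat-dropPieces zero    []       = refl
concat-dropPieces (suc r) []       = refl
concat-dropPieces r       (p ∷ ps) =
  trans (cong (drop r p ++_) (concat-dropPieces (r ∸ List.length p) ps)) (sym (drop-++ r p (concat ps)))

module _ (b : ℕ) .{{_ : NonZero b}} where

  product-pay-dropPieces : ∀ r ps → product (map (pay b) (dropPieces r ps)) ≤ product (map (pay b) ps)
  product-pay-dropPieces r []       = ≤-refl
  product-pay-dropPieces r (p ∷ ps) =
    *-mono-≤ (pay-drop b r p) (product-pay-dropPieces (r ∸ List.length p) ps)

  blockLayouts : List Bool → ℕ
  blockLayouts B = product (map (λ block → b C class block) (blocks b B))

  class-take≤b : ∀ B → class (take b B) ≤ b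
  class-take≤b B = ≤-trans (class≤length (take b B)) (≤-trans (≤-reflexive (length-take b B)) (m⊓n≤m b _))

  -- If the piece has at least `b` bits, the block lies inside it and `layouts-++` applies.
  -- Otherwise the piece ends in the block, nothing of it is left, and its slack `2 ^ b` covers the
  -- whole block, whatever bits `B` contributes.
  pay-take : ∀ x p B → (b C class (take b (x ∷ p ++ B))) * pay b (drop b (x ∷ p)) ≤ pay b (x ∷ p)
  pay-take x p B with ≤-total b (suc (List.length p))
  ... | inj₁ b≤ = begin
    (b C class (take b (x ∷ p ++ B))) * (layouts D * slack b D)
      ≡⟨ cong (λ q → (b C class q) * (layouts D * slack b D)) (take-++-≤ (x ∷ p) B b≤) ⟩
    (b C class W) * (layouts D * slack b D)
      ≡⟨ cong (λ n → (n C class W) * (layouts D * slack b D)) (trans (length-take b (x ∷ p)) (m≤n⇒m⊓n≡m b≤)) ⟨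
    layouts W * (layouts D * slack b D)
      ≡⟨ *-assoc (layouts W) _ _ ⟨
    layouts W * layouts D * slack b D
      ≤⟨ *-mono-≤ (layouts-++ W D) (slack-drop b b (x ∷ p)) ⟩
    layouts (W ++ D) * slack b (x ∷ p)
      ≡⟨ cong (λ q → layouts q * slack b (x ∷ p)) (take++drop≡id b (x ∷ p)) ⟩
    pay b (x ∷ p) ∎
    where
    open ≤-Reasoning
    W = take b (x ∷ p)
    D = drop b (x ∷ p)
  ... | inj₂ ≤b = begin
    (b C c) * pay b (drop b (x ∷ p))
      ≡⟨ cong (λ q → (b C c) * pay b q) (drop-all b (x ∷ p) ≤b) ⟩
    (b C c) * 1
      ≡⟨ *-identityʳ (b C c) ⟩
    b C c
      ≤⟨ nCk≤2ⁿ (class-take≤b (x ∷ p ++ B)) ⟩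
    2 ^ b
      ≤⟨ m≤n*m (2 ^ b) (layouts (x ∷ p)) {{>-nonZero (layouts>0 (x ∷ p))}} ⟩
    pay b (x ∷ p) ∎
    where
    open ≤-Reasoning
    c = class (take b (x ∷ p ++ B))

  -- The front block is charged to the first nonempty piece; the other pieces that it reaches into
  -- only shrink, which does not increase `pay`. As one block can cut through several pieces, the
  -- recursion runs on a bound for the number of bits.
  blockLayouts-concat : ∀ ps → blockLayouts (concat ps) ≤ product (map (pay b) ps)
  blockLayouts-concat ps = go _ ps ≤-refl
    where
    open ≤-Reasoning
    product′ : List (List Bool) → ℕ
    product′ bs = product (map (λ block → b C class block) bs)

    go : ∀ fuel ps → List.length (concat ps) ≤ fuel → blockLayouts (concat ps) ≤ product (map (pay b) ps)
    go fuel []       _ = ≤-reflexive (cong product′ (blocks-[] b))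
    go fuel ([] ∷ ps) len≤ = subst (blockLayouts (concat ps) ≤_) (sym (*-identityˡ _)) (go fuel ps len≤)
    go (suc fuel) ((x ∷ p) ∷ ps) (s≤s len≤) = begin
      blockLayouts (x ∷ p ++ concat ps)
        ≡⟨ cong product′ (blocks-∷ b x (p ++ concat ps)) ⟩
      (b C class block) * blockLayouts (drop b (x ∷ p ++ concat ps))
        ≡⟨ cong (λ B → (b C class block) * blockLayouts B) (concat-dropPieces b ((x ∷ p) ∷ ps)) ⟨
      (b C class block) * blockLayouts (concat ps′)
        ≤⟨ *-monoʳ-≤ (b C class block) (go fuel ps′ shorter) ⟩
      (b C class block) * (pay b (drop b (x ∷ p)) * product (map (pay b) (dropPieces (b ∸ suc (List.length p)) ps)))
        ≡⟨ *-assoc (b C class block) _ _ ⟨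
      (b C class block) * pay b (drop b (x ∷ p)) * product (map (pay b) (dropPieces (b ∸ suc (List.length p)) ps))
        ≤⟨ *-mono-≤ first (product-pay-dropPieces (b ∸ suc (List.length p)) ps) ⟩
      pay b (x ∷ p) * product (map (pay b) ps) ∎
      where
      block = take b (x ∷ (p ++ concat ps) ++ replicate b false)
      ps′ = dropPieces b ((x ∷ p) ∷ ps)

      first : (b C class block) * pay b (drop b (x ∷ p)) ≤ pay b (x ∷ p)
      first rewrite ++-assoc p (concat ps) (replicate b false) = pay-take x p _

      shorter : List.length (concat ps′) ≤ fuel
      shorter = begin
        List.length (concat ps′)
          ≡⟨ cong List.length (concat-dropPieces b ((x ∷ p) ∷ ps)) ⟩
        List.length (drop b (x ∷ p ++ concat ps))
          ≡⟨ length-drop b (x ∷ p ++ concat ps) ⟩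
        suc (List.length (p ++ concat ps)) ∸ b
          -- As `b` is nonzero, every block consumes at least one bit.
          ≤⟨ ∸-monoʳ-≤ (suc (List.length (p ++ concat ps))) (>-nonZero⁻¹ b) ⟩
        List.length (p ++ concat ps)
          ≤⟨ len≤ ⟩
        fuel ∎

-- Products over lists

product-map-* : ∀ (f g : A → ℕ) xs →
                product (map (λ x → f x * g x) xs) ≡ product (map f xs) * product (map g xs)
product-map-* f g []       = refl
product-map-* f g (x ∷ xs) = trans
  (cong (f x * g x *_) (product-map-* f g xs))
  ([m*n]*[o*p]≡[m*o]*[n*p] (f x) (g x) _ _)

product-map-mono : ∀ {f g : A → ℕ} → (∀ x → f x ≤ g x) → ∀ xs → product (map f xs) ≤ product (map g xs)
product-map-mono f≤g []       = ≤-refl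
product-map-mono f≤g (x ∷ xs) = *-mono-≤ (f≤g x) (product-map-mono f≤g xs)

product-map-1 : ∀ (xs : List A) → product (map (λ _ → 1) xs) ≡ 1
product-map-1 []       = refl
product-map-1 (x ∷ xs) = trans (*-identityˡ _) (product-map-1 xs)

product-map-const : ∀ n (xs : List A) → product (map (λ _ → n) xs) ≡ n ^ List.length xs
product-map-const n []       = refl
product-map-const n (x ∷ xs) = cong (n *_) (product-map-const n xs)

Unique-++⁻ : ∀ (xs : List A) {ys} → Unique (xs ++ ys) → Unique xs × Unique ys × Disjoint xs ys
Unique-++⁻ []       ys! = [] , ys! , λ ()
Unique-++⁻ (x ∷ xs) (x∉ ∷ xs++ys!) with Unique-++⁻ xs xs++ys! | All.++⁻ xs x∉
... | xs! , ys! , xs#ys | x∉xs , x∉ys = x∉xs ∷ xs! , ys! , λ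
  { (here refl  , x∈ys) → contradiction refl (All.lookup x∉ys x∈ys)
  ; (there x∈xs , x∈ys) → xs#ys (x∈xs , x∈ys)
  }

-- Occurrence counts

count-↭ : ∀ {xs ys : List (Fin σ)} x → xs ↭ ys → count x xs ≡ count x ys
count-↭ x xs↭ys = ↭-length (filter-↭ (x ≟_) xs↭ys)

-- Regroups a product over positions by values: each entry of `L` meets exactly one element of the
-- duplicate-free list `xs`.
product-map-^count : ∀ {xs : List (Fin σ)} (f : Fin σ → ℕ) L → Unique xs → All (_∈ xs) L →
                     product (map f L) ≡ product (map (λ x → f x ^ count x L) xs)
product-map-^count {xs = xs} f []      _   []           = sym (product-map-1 xs)
product-map-^count {xs = xs} f (y ∷ L) xs! (y∈xs ∷ L⊆xs) = begin
  f y * product (map f L)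
    ≡⟨ cong₂ _*_ (sym (single xs! y∈xs)) (product-map-^count f L xs! L⊆xs) ⟩
  product (map (λ x → f x ^ count x (y ∷ [])) xs) * product (map (λ x → f x ^ count x L) xs)
    ≡⟨ product-map-* _ _ xs ⟨
  product (map (λ x → f x ^ count x (y ∷ []) * f x ^ count x L) xs)
    ≡⟨ cong product (map-cong step xs) ⟩
  product (map (λ x → f x ^ count x (y ∷ L)) xs) ∎
  where
  open ≡-Reasoning
  step : ∀ x → f x ^ count x (y ∷ []) * f x ^ count x L ≡ f x ^ count x (y ∷ L)
  step x with x ≟ y
  ... | yes _ = cong (_* f x ^ count x L) (*-identityʳ (f x))
  ... | no  _ = *-identityˡ _

  absent : ∀ {zs} → All (y ≢_) zs → product (map (λ x → f x ^ count x (y ∷ [])) zs) ≡ 1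
  absent []                  = refl
  absent (_∷_ {z} y≢z y∉zs) with z ≟ y
  ... | yes z≡y = contradiction (sym z≡y) y≢z
  ... | no  _   = trans (*-identityˡ _) (absent y∉zs)

  single : ∀ {zs} → Unique zs → y ∈ zs → product (map (λ x → f x ^ count x (y ∷ [])) zs) ≡ f y
  single (y∉zs ∷ _) (here refl) with y ≟ y
  ... | yes _   = trans (cong₂ _*_ (*-identityʳ (f y)) (absent y∉zs)) (*-identityʳ (f y))
  ... | no  y≢y = contradiction refl y≢y
  single (_∷_ {z} z∉zs zs!) (there y∈zs) with z ≟ y
  ... | yes refl = contradiction refl (All.lookup z∉zs y∈zs)
  ... | no  _    = trans (*-identityˡ _) (single zs! y∈zs)

-- ∏ c_x ^ c_x as a product over positions: the alphabet does not occur, so that relabelling is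
-- harmless.

selfCount : List (Fin σ) → ℕ
selfCount L = product (map (λ y → count y L) L)

selfCount-↭ : ∀ {xs ys : List (Fin σ)} → xs ↭ ys → selfCount xs ≡ selfCount ys
selfCount-↭ {xs = xs} {ys} xs↭ys = trans
  (cong product (map-cong (λ y → count-↭ y xs↭ys) xs))
  (product-↭ (↭-map⁺ (λ y → count y ys) xs↭ys))

-- Injectivity is asked only between `y` and the entries of `L`, since an RML function is one-to-one
-- only on each set `N_out`.
count-map : ∀ {f : Fin σ → Fin σ} y L → (∀ {x} → x ∈ L → f y ≡ f x → y ≡ x) →
            count (f y) (map f L) ≡ count y L
count-map         y []      _   = refl
count-map {f = f} y (x ∷ L) inj with f y ≟ f x | y ≟ x
... | yes _     | yes _    = cong suc (count-map y L (inj ∘ there))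
... | yes fy≡fx | no  y≢x  = contradiction (inj (here refl) fy≡fx) y≢x
... | no  fy≢fx | yes refl = contradiction refl fy≢fx
... | no  _     | no  _    = count-map y L (inj ∘ there)

selfCount-map : ∀ {f : Fin σ → Fin σ} L → (∀ {x y} → x ∈ L → y ∈ L → f x ≡ f y → x ≡ y) →
                selfCount (map f L) ≡ selfCount L
selfCount-map {f = f} L inj = cong product (trans
  (sym (map-∘ L))
  (map-cong-local (All.tabulate (λ {y} y∈L → count-map y L (inj y∈L)))))

-- Wavelet trees

_∈leaves?_ : (x : Fin σ) (t : Tree (Fin σ)) → _
x ∈leaves? t = _∈?_ _≟_ x (leaves t)

bitVector-++ : ∀ (S S′ : List (Fin σ)) l r →
               bitVector (S ++ S′) l r ≡ bitVector S l r ++ bitVector S′ l r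
bitVector-++ S S′ l r = trans
  (cong (map _) (filter-++ (_∈leaves? node l r) S S′))
  (map-++ _ (filter (_∈leaves? node l r) S) _)

bitVector-concat : ∀ (Ls : List (List (Fin σ))) l r →
                   bitVector (concat Ls) l r ≡ concat (map (λ L → bitVector L l r) Ls)
bitVector-concat []       l r = refl
bitVector-concat (L ∷ Ls) l r = trans (bitVector-++ L (concat Ls) l r)
  (cong (bitVector L l r ++_) (bitVector-concat Ls l r))

length-filter-⊎ : ∀ {P Q R : A → Set} (P? : Decidable P) (Q? : Decidable Q) (R? : Decidable R) →
  Q ⊆ P → R ⊆ P → (∀ {x} → P x → (Q x → R x → ⊥) × (Q x ⊎ R x)) →
  ∀ xs → List.length (filter P? xs) ≡ List.length (filter Q? xs) + List.length (filter R? xs)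
length-filter-⊎ P? Q? R? Q⊆P R⊆P P⊆ []       = refl
length-filter-⊎ P? Q? R? Q⊆P R⊆P P⊆ (x ∷ xs)
  with rec ← length-filter-⊎ P? Q? R? Q⊆P R⊆P P⊆ xs | P? x | Q? x | R? x
... | yes p | yes q | yes r = contradiction r (proj₁ (P⊆ p) q)
... | yes p | yes q | no ¬r = cong suc rec
... | yes p | no ¬q | yes r = trans (cong suc rec) (sym (+-suc _ _))
... | yes p | no ¬q | no ¬r = contradiction (proj₂ (P⊆ p)) [ ¬q , ¬r ]′
... | no ¬p | yes q | _     = contradiction (Q⊆P q) ¬p
... | no ¬p | no ¬q | yes r = contradiction (R⊆P r) ¬p
... | no ¬p | no ¬q | no ¬r = rec

class-map-does : ∀ {P R : A → Set} (P? : Decidable P) (R? : Decidable R) → R ⊆ P →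
  ∀ xs → class (map (does ∘ R?) (filter P? xs)) ≡ List.length (filter R? xs)
class-map-does P? R? R⊆P []       = refl
class-map-does P? R? R⊆P (x ∷ xs) with rec ← class-map-does P? R? R⊆P xs | P? x
class-map-does P? R? R⊆P (x ∷ xs) | yes p with R? x
... | yes r = cong suc rec
... | no ¬r = rec
class-map-does P? R? R⊆P (x ∷ xs) | no ¬p with R? x
... | yes r = contradiction (R⊆P r) ¬p
... | no ¬r = rec

#below : Tree (Fin σ) → List (Fin σ) → ℕ
#below t L = List.length (filter (_∈leaves? t) L)

class-bitVector : ∀ L (l r : Tree (Fin σ)) → class (bitVector L l r) ≡ #below r L
class-bitVector L l r = class-map-does (_∈leaves? node l r) (_∈leaves? r) (∈-++⁺ʳ (leaves l)) L

length-bitVector : ∀ L (l r : Tree (Fin σ)) → List.length (bitVector L l r) ≡ #below (node l r) L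
length-bitVector L l r = length-map _ (filter (_∈leaves? node l r) L)

#below-node : ∀ L (l r : Tree (Fin σ)) → Disjoint (leaves l) (leaves r) →
              #below (node l r) L ≡ #below r L + #below l L
#below-node L l r l#r = length-filter-⊎ (_∈leaves? node l r) (_∈leaves? r) (_∈leaves? l)
  (∈-++⁺ʳ (leaves l)) ∈-++⁺ˡ
  (λ x∈ → (λ x∈r x∈l → l#r (x∈l , x∈r)) , Sum.swap (∈-++⁻ (leaves l) x∈)) L

-- With distinct leaves, the binomial coefficients of the nodes telescope to the multinomial
-- coefficient of the counts in `L` of the leaf symbols.
treeLayouts : List (Fin σ) → Tree (Fin σ) → ℕ
treeLayouts L (leaf x)   = 1
treeLayouts L (node l r) = layouts (bitVector L l r) * (treeLayouts L l * treeLayouts L r)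

-- At a node with `nr` and `nl` occurrences below its children, the term of the binomial theorem
-- with `x = nr` and `y = nl` merges the two inductive bounds. Leaves absent from `L` contribute
-- `0 ^ 0 = 1`.
treeLayouts-bound : ∀ L (t : Tree (Fin σ)) → Unique (leaves t) →
  treeLayouts L t * product (map (λ x → count x L ^ count x L) (leaves t)) ≤ #below t L ^ #below t L
treeLayouts-bound L (leaf x) _ = ≤-reflexive (trans (*-identityˡ _) (trans (*-identityʳ _)
  (cong (λ n → n ^ n) (cong List.length (filter-≐ (x ≟_) (_∈leaves? leaf x)
    ((λ { refl → here refl }) , λ { (here refl) → refl }) L)))))
treeLayouts-bound L (node l r) lr! with Unique-++⁻ (leaves l) lr!
... | l! , r! , l#r = begin
  layouts bv * (Tl * Tr) * product (map f (leaves l ++ leaves r))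
    ≡⟨ cong₂ (λ a p → a * (Tl * Tr) * p) layouts≡ product≡ ⟩
  ((nr + nl) C nr) * (Tl * Tr) * (product (map f (leaves l)) * product (map f (leaves r)))
    ≡⟨ rearrange ((nr + nl) C nr) Tl Tr _ _ ⟩
  ((nr + nl) C nr) * ((Tr * product (map f (leaves r))) * (Tl * product (map f (leaves l))))
    ≤⟨ *-monoʳ-≤ ((nr + nl) C nr) (*-mono-≤ (treeLayouts-bound L r r!) (treeLayouts-bound L l l!)) ⟩
  ((nr + nl) C nr) * (nr ^ nr * nl ^ nl)
    ≤⟨ [m+n]Cm*xᵐ*yⁿ≤[x+y]ᵐ⁺ⁿ nr nl nr nl ⟩
  (nr + nl) ^ (nr + nl)
    ≡⟨ cong (λ n → n ^ n) (#below-node L l r l#r) ⟨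
  #below (node l r) L ^ #below (node l r) L ∎
  where
  open ≤-Reasoning
  f = λ x → count x L ^ count x L
  bv = bitVector L l r
  nl = #below l L
  nr = #below r L
  Tl = treeLayouts L l
  Tr = treeLayouts L r
  layouts≡ : layouts bv ≡ (nr + nl) C nr
  layouts≡ = cong₂ _C_ (trans (length-bitVector L l r) (#below-node L l r l#r)) (class-bitVector L l r)
  product≡ : product (map f (leaves l ++ leaves r)) ≡ product (map f (leaves l)) * product (map f (leaves r))
  product≡ = trans (cong product (map-++ f (leaves l) (leaves r))) (product-++ (map f (leaves l)) _)
  rearrange : ∀ c a b p q → c * (a * b) * (p * q) ≡ c * ((b * q) * (a * p))
  rearrange = solve-∀

-- Relabelled pieces

module _ {L Q : List (Fin σ)} (f : Fin σ → Fin σ) (L↭ : L ↭ map f Q)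
         (f-inj : ∀ {x y} → x ∈ Q → y ∈ Q → f x ≡ f y → x ≡ y) where

  -- The count products range over different sets: the alphabet for `Q`, the labels at the leaves
  -- for `L`. Each is a `selfCount`, and this is invariant under permutation and under a relabelling
  -- that is one-to-one on the symbols present.
  treeLayouts-relabelled : ∀ t → Unique (leaves t) → All (_∈ leaves t) L →
    treeLayouts L t * product (map (λ x → count x Q ^ count x Q) (allFin σ)) ≤ List.length Q ^ List.length Q
  treeLayouts-relabelled t t! L⊆t = begin
    treeLayouts L t * product (map (λ x → count x Q ^ count x Q) (allFin σ))
      ≡⟨ cong (treeLayouts L t *_) (product-map-^count (λ x → count x Q) Q (allFin⁺ σ) (All.universal ∈-allFin Q)) ⟨
    treeLayouts L t * selfCount Q
      ≡⟨ cong (treeLayouts L t *_) (trans (selfCount-↭ L↭) (selfCount-map Q f-inj)) ⟨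
    treeLayouts L t * selfCount L
      ≡⟨ cong (treeLayouts L t *_) (product-map-^count (λ x → count x L) L t! L⊆t) ⟩
    treeLayouts L t * product (map (λ x → count x L ^ count x L) (leaves t))
      ≤⟨ treeLayouts-bound L t t! ⟩
    #below t L ^ #below t L
      ≡⟨ cong (λ n → n ^ n) (trans (cong List.length (filter-all (_∈leaves? t) L⊆t))
                                   (trans (↭-length L↭) (length-map f Q))) ⟩
    List.length Q ^ List.length Q ∎
    where open ≤-Reasoning

-- All nodes and all pieces of the wavelet tree

internalNodes : Tree A → ℕ
internalNodes (leaf _)   = 0
internalNodes (node l r) = suc (internalNodes l + internalNodes r)

internalNodes<leaves : (t : Tree A) → internalNodes t < List.length (leaves t)
internalNodes<leaves (leaf _)   = ≤-refl
internalNodes<leaves (node l r) = begin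
  suc (suc (internalNodes l + internalNodes r))
    ≡⟨ cong suc (+-suc (internalNodes l) _) ⟨
  suc (internalNodes l) + suc (internalNodes r)
    ≤⟨ +-mono-≤ (internalNodes<leaves l) (internalNodes<leaves r) ⟩
  List.length (leaves l) + List.length (leaves r)
    ≡⟨ length-++ (leaves l) ⟨
  List.length (leaves l ++ leaves r) ∎
  where open ≤-Reasoning

module _ (b : ℕ) .{{_ : NonZero b}} where

  hwtLayouts : List (Fin σ) → Tree (Fin σ) → ℕ
  hwtLayouts S t = product (map (blockLayouts b) (bitVectors S t))

  -- A nonempty piece may have no symbol below the node, hence only an inequality. It allows the
  -- same slack to be charged at every node.
  slack-bitVector : ∀ L (l r : Tree (Fin σ)) → slack b (bitVector L l r) ≤ slack b L
  slack-bitVector []      l r = ≤-refl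
  slack-bitVector (x ∷ L) l r with bitVector (x ∷ L) l r
  ... | []    = m^n>0 2 b
  ... | _ ∷ _ = ≤-refl

  -- Each internal node contributes one copy of the total slack of the pieces; the layout counts are
  -- regrouped from nodes to pieces.
  hwtLayouts-concat : ∀ (Ls : List (List (Fin σ))) t →
    hwtLayouts (concat Ls) t ≤
    product (map (slack b) Ls) ^ internalNodes t * product (map (λ L → treeLayouts L t) Ls)
  hwtLayouts-concat Ls (leaf x)   = ≤-reflexive (sym (trans (*-identityˡ _) (product-map-1 Ls)))
  hwtLayouts-concat Ls (node l r) = begin
    blockLayouts b (bitVector S l r) * product (map (blockLayouts b) (bitVectors S l ++ bitVectors S r))
      ≡⟨ cong₂ _*_ (cong (blockLayouts b) (bitVector-concat Ls l r))
                   (trans (cong product (map-++ _ (bitVectors S l) _))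
                          (product-++ (map (blockLayouts b) (bitVectors S l)) _)) ⟩
    blockLayouts b (concat (map bv Ls)) * (hwtLayouts S l * hwtLayouts S r)
      ≤⟨ *-mono-≤ top (*-mono-≤ (hwtLayouts-concat Ls l) (hwtLayouts-concat Ls r)) ⟩
    V * P * (P ^ nl * Tl * (P ^ nr * Tr))
      ≡⟨ rearrange V P (P ^ nl) Tl (P ^ nr) Tr ⟩
    P * (P ^ nl * P ^ nr) * (V * (Tl * Tr))
      ≡⟨ cong₂ (λ p q → P * p * q) (^-distribˡ-+-* P nl nr) products ⟨
    P ^ suc (nl + nr) * product (map (λ L → treeLayouts L (node l r)) Ls) ∎
    where
    open ≤-Reasoning
    S = concat Ls
    bv = λ L → bitVector L l r
    V = product (map (layouts ∘ bv) Ls)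
    P = product (map (slack b) Ls)
    Tl = product (map (λ L → treeLayouts L l) Ls)
    Tr = product (map (λ L → treeLayouts L r) Ls)
    nl = internalNodes l
    nr = internalNodes r

    top : blockLayouts b (concat (map bv Ls)) ≤ V * P
    top = begin
      blockLayouts b (concat (map bv Ls))
        ≤⟨ blockLayouts-concat b (map bv Ls) ⟩
      product (map (pay b) (map bv Ls))
        ≡⟨ cong product (map-∘ Ls) ⟨
      product (map (λ L → layouts (bv L) * slack b (bv L)) Ls)
        ≡⟨ product-map-* _ _ Ls ⟩
      V * product (map (λ L → slack b (bv L)) Ls)
        ≤⟨ *-monoʳ-≤ V (product-map-mono (λ L → slack-bitVector L l r) Ls) ⟩
      V * P ∎

    products : product (map (λ L → treeLayouts L (node l r)) Ls) ≡ V * (Tl * Tr)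
    products = trans (product-map-* _ _ Ls) (cong (V *_) (product-map-* _ _ Ls))

    rearrange : ∀ v p pl tl pr tr → v * p * (pl * tl * (pr * tr)) ≡ p * (pl * pr) * (v * (tl * tr))
    rearrange = solve-∀

product-slack : ∀ b (Ls : List (List A)) →
                product (map (slack b) Ls) ≡ 2 ^ (b * List.length (filter (λ L → 0 <? List.length L) Ls))
product-slack b []             = cong (2 ^_) (sym (*-zeroʳ b))
product-slack b ([] ∷ Ls)      = trans (*-identityˡ _) (product-slack b Ls)
product-slack b ((_ ∷ _) ∷ Ls) = trans (cong (2 ^ b *_) (product-slack b Ls))
  (trans (sym (^-distribˡ-+-* 2 b _)) (cong (2 ^_) (sym (*-suc b _))))

-- Lower bounds on LogReal

-- lg (P/Q) ≤ n x.  The quotient is needed because the terms of H₀ are logarithms of fractions;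
-- only the multinomial coefficient, compared with their sum, is a natural number.

infix 4 lg[_/_]≤_·_
lg[_/_]≤_·_ : ℕ → ℕ → ℕ → LogReal → Set
lg[ P / Q ]≤ n · x = P ^ root x * den x ^ n ≤ Q ^ root x * num x ^ n

^-distribʳ-* : ∀ k m n → (m * n) ^ k ≡ m ^ k * n ^ k
^-distribʳ-* zero    m n = refl
^-distribʳ-* (suc k) m n = trans (cong (m * n *_) (^-distribʳ-* k m n))
  ([m*n]*[o*p]≡[m*o]*[n*p] m n (m ^ k) (n ^ k))

^-swap : ∀ m j k → (m ^ j) ^ k ≡ (m ^ k) ^ j
^-swap m j k = trans (^-*-assoc m j k) (trans (cong (m ^_) (*-comm j k)) (sym (^-*-assoc m k j)))

-- Each hypothesis is raised to the root of the other summand, which gives both the common root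
-- `root x * root y`; then they are multiplied.
lg≤-+ : ∀ {P Q P′ Q′} n x y → lg[ P / Q ]≤ n · x → lg[ P′ / Q′ ]≤ n · y →
        lg[ P * P′ / Q * Q′ ]≤ n · (x +ᴸ y)
lg≤-+ {P} {Q} {P′} {Q′} n x y P/Q≤x P′/Q′≤y = begin
  (P * P′) ^ (d * d′) * (den x ^ d′ * den y ^ d) ^ n
    ≡⟨ regroup P P′ (den x) (den y) ⟩
  (P ^ d * den x ^ n) ^ d′ * (P′ ^ d′ * den y ^ n) ^ d
    ≤⟨ *-mono-≤ (^-monoˡ-≤ d′ P/Q≤x) (^-monoˡ-≤ d P′/Q′≤y) ⟩
  (Q ^ d * num x ^ n) ^ d′ * (Q′ ^ d′ * num y ^ n) ^ d
    ≡⟨ regroup Q Q′ (num x) (num y) ⟨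
  (Q * Q′) ^ (d * d′) * (num x ^ d′ * num y ^ d) ^ n ∎
  where
  open ≤-Reasoning
  d = root x
  d′ = root y

  regroup : ∀ P P′ q q′ → (P * P′) ^ (d * d′) * (q ^ d′ * q′ ^ d) ^ n ≡
            (P ^ d * q ^ n) ^ d′ * (P′ ^ d′ * q′ ^ n) ^ d
  regroup P P′ q q′ = begin-equality
    (P * P′) ^ (d * d′) * (q ^ d′ * q′ ^ d) ^ n
      ≡⟨ cong₂ _*_ (^-distribʳ-* (d * d′) P P′) (^-distribʳ-* n (q ^ d′) (q′ ^ d)) ⟩
    P ^ (d * d′) * P′ ^ (d * d′) * ((q ^ d′) ^ n * (q′ ^ d) ^ n)
      ≡⟨ cong₂ (λ a b → a * b * ((q ^ d′) ^ n * (q′ ^ d) ^ n)) (sym (^-*-assoc P d d′))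
               (trans (cong (P′ ^_) (*-comm d d′)) (sym (^-*-assoc P′ d′ d))) ⟩
    (P ^ d) ^ d′ * (P′ ^ d′) ^ d * ((q ^ d′) ^ n * (q′ ^ d) ^ n)
      ≡⟨ cong₂ (λ a b → (P ^ d) ^ d′ * (P′ ^ d′) ^ d * (a * b)) (^-swap q d′ n) (^-swap q′ d n) ⟩
    (P ^ d) ^ d′ * (P′ ^ d′) ^ d * ((q ^ n) ^ d′ * (q′ ^ n) ^ d)
      ≡⟨ [m*n]*[o*p]≡[m*o]*[n*p] ((P ^ d) ^ d′) _ _ _ ⟩
    (P ^ d) ^ d′ * (q ^ n) ^ d′ * ((P′ ^ d′) ^ d * (q′ ^ n) ^ d)
      ≡⟨ cong₂ _*_ (^-distribʳ-* d′ (P ^ d) (q ^ n)) (^-distribʳ-* d (P′ ^ d′) (q′ ^ n)) ⟨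
    (P ^ d * q ^ n) ^ d′ * (P′ ^ d′ * q′ ^ n) ^ d ∎

lg≤-sum : ∀ n (P Q : A → ℕ) (g : A → LogReal) xs → (∀ x → lg[ P x / Q x ]≤ n · g x) →
          lg[ product (map P xs) / product (map Q xs) ]≤ n · sumᴸ (map g xs)
lg≤-sum n P Q g []       P/Q≤g = ≤-refl
lg≤-sum n P Q g (x ∷ xs) P/Q≤g = lg≤-+ n (g x) (sumᴸ (map g xs)) (P/Q≤g x) (lg≤-sum n P Q g xs P/Q≤g)

-- Since `n · (m / n) x = m x` and the root gains a factor `n`, the conclusion is the `n`-th power
-- of the hypothesis.
lg≤-scale : ∀ {P Q} m n .{{_ : NonZero n}} x → lg[ P / Q ]≤ m · x → lg[ P / Q ]≤ n · ([ m / n ]· x)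
lg≤-scale {P} {Q} m n x P/Q≤x = subst₂ _≤_
  (sym (regroup P (den x))) (sym (regroup Q (num x))) (^-monoˡ-≤ n P/Q≤x)
  where
  regroup : ∀ P q → P ^ (n * root x) * (q ^ m) ^ n ≡ (P ^ root x * q ^ m) ^ n
  regroup P q = trans
    (cong (_* (q ^ m) ^ n) (trans (cong (P ^_) (*-comm n (root x))) (sym (^-*-assoc P (root x) n))))
    (sym (^-distribʳ-* n (P ^ root x) (q ^ m)))

-- Entropy as the logarithm of a quotient

lg≤-lg : ∀ n c → lg[ suc n ^ c / c ^ c ]≤ c · lg[ suc n / c ]
-- Here `lg[ suc n / 0 ]` has its default value 0 and `0 ^ 0 = 1`, so both sides compute to 1.
lg≤-lg n zero      = ≤-refl
lg≤-lg n c@(suc _) = ≤-reflexive (trans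
  (cong₂ _*_ (*-identityʳ (suc n ^ c)) (sym (*-identityʳ (c ^ c))))
  (*-comm (suc n ^ c) _))

-- Returns from the fraction `P / Q` to a natural number below it, by cancelling a power of `Q`.
lg≤-cancel : ∀ {M P Q} .{{_ : NonZero Q}} n x → M * Q ≤ P → lg[ P / Q ]≤ n · x → lg[ M / 1 ]≤ n · x
lg≤-cancel {M} {P} {Q} n x MQ≤P P/Q≤x = *-cancelˡ-≤ (Q ^ d) {{m^n≢0 Q d}} (begin
  Q ^ d * (M ^ d * den x ^ n)
    ≡⟨ *-assoc (Q ^ d) _ _ ⟨
  Q ^ d * M ^ d * den x ^ n
    ≡⟨ cong (_* den x ^ n) (trans (*-comm (Q ^ d) _) (sym (^-distribʳ-* d M Q))) ⟩
  (M * Q) ^ d * den x ^ n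
    ≤⟨ *-monoˡ-≤ (den x ^ n) (^-monoˡ-≤ d MQ≤P) ⟩
  P ^ d * den x ^ n
    ≤⟨ P/Q≤x ⟩
  Q ^ d * num x ^ n
    ≡⟨ cong (Q ^ d *_) (trans (cong (_* num x ^ n) (^-zeroˡ d)) (*-identityˡ _)) ⟨
  Q ^ d * (1 ^ d * num x ^ n)   ∎)
  where
  open ≤-Reasoning
  d = root x

-- Sums `c lg (n / c)` over the alphabet, `c` being the count of a symbol and `n` the length; as
-- real numbers the two sides coincide.
lg≤-H₀ : ∀ (S : List (Fin σ)) →
  lg[ List.length S ^ List.length S / product (map (λ x → count x S ^ count x S) (allFin σ)) ]≤
  List.length S · H₀ S
lg≤-H₀ {σ} []         = ≤-reflexive (cong (λ p → p ^ 1 * 1) (sym (product-map-1 (allFin σ))))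
lg≤-H₀ {σ} S@(_ ∷ xs) = subst
  (λ P → lg[ P / product (map (λ x → count x S ^ count x S) (allFin σ)) ]≤ n · H₀ S) total
  (lg≤-sum n (λ x → n ^ count x S) (λ x → count x S ^ count x S)
    (λ x → [ count x S / n ]· lg[ n / count x S ]) (allFin σ)
    (λ x → lg≤-scale (count x S) n lg[ n / count x S ] (lg≤-lg (List.length xs) (count x S))))
  where
  n = List.length S
  total : product (map (λ x → n ^ count x S) (allFin σ)) ≡ n ^ n
  -- The counts sum to `n`: this is the regrouping by values of a constant function.
  total = trans (sym (product-map-^count (λ _ → n) S (allFin⁺ σ) (All.universal ∈-allFin S)))
    (product-map-const n S)

n^n≢0 : ∀ n → NonZero (n ^ n)
n^n≢0 zero    = _
n^n≢0 (suc n) = m^n≢0 (suc n) (suc n)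

lg≤-H₀-layouts : ∀ {M} (S : List (Fin σ)) →
  M * product (map (λ x → count x S ^ count x S) (allFin σ)) ≤ List.length S ^ List.length S →
  lg[ M / 1 ]≤ List.length S · H₀ S
lg≤-H₀-layouts {σ} S M≤ = lg≤-cancel
  {{product≢0 (All.map⁺ (All.universal (λ x → n^n≢0 (count x S)) (allFin σ)))}}
  (List.length S) (H₀ S) M≤ (lg≤-H₀ S)

-- Sizes as logarithms of natural numbers

record IsLg (n : ℕ) (x : LogReal) : Set where
  constructor isLg
  field
    num≡n  : num x ≡ n
    den≡1  : den x ≡ 1
    root≡1 : root x ≡ 1

IsLg-lg : ∀ n → 1 ≤ n → IsLg n (lg n)
IsLg-lg (suc n) _ = isLg refl refl refl

-- The triple stays literally `(n , 1 , 1)`, not merely equal as a real number: with both roots 1,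
-- the powers in `_+ᴸ_` are trivial.
IsLg-+ : ∀ {m n} x y → IsLg m x → IsLg n y → IsLg (m * n) (x +ᴸ y)
IsLg-+ {m} {n} x y (isLg p q d) (isLg p′ q′ d′) = isLg
  (cong₂ _*_ (trans (cong₂ _^_ p d′) (^-identityʳ m)) (trans (cong₂ _^_ p′ d) (^-identityʳ n)))
  (cong₂ _*_ (cong₂ _^_ q d′) (cong₂ _^_ q′ d))
  (cong₂ _*_ d d′)

IsLg-sum : ∀ (f : A → ℕ) (g : A → LogReal) {xs} → All (λ x → IsLg (f x) (g x)) xs →
           IsLg (product (map f xs)) (sumᴸ (map g xs))
IsLg-sum f g []                  = isLg refl refl refl
IsLg-sum f g (_∷_ {x} {xs} p ps) = IsLg-+ (g x) (sumᴸ (map g xs)) p (IsLg-sum f g ps)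

IsLg-rrrBits : ∀ b .{{_ : NonZero b}} B → IsLg (blockLayouts b B) (rrrBits b B)
IsLg-rrrBits b B = IsLg-sum (λ block → b C class block) (λ block → lg (b C class block))
  (All.map⁺ (All.universal
    -- The default value of `lg` at 0 must be excluded: a block has at most `b` ones, padding
    -- included, so its coefficient is positive.
    (λ j → IsLg-lg _ (nCk>0 (class-take≤b b (drop (j * b) (B ++ replicate b false)))))
    (upTo ((List.length B + pred b) / b))))

IsLg-hwtBits : ∀ b .{{_ : NonZero b}} (S : List (Fin σ)) t → IsLg (hwtLayouts b S t) (hwtBits b S t)
IsLg-hwtBits b S t = IsLg-sum (blockLayouts b) (rrrBits b) (All.universal (IsLg-rrrBits b) (bitVectors S t))

-- As real numbers, `x = lg P ≤ m + lg M ≤ m + n y`. The other steps remove the exponents 1 that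
-- `[ n / 1 ]·` and `fromℕ` bring in.
IsLg⇒≤ᴸ : ∀ {P M} m n x y → IsLg P x → P ≤ 2 ^ m * M → lg[ M / 1 ]≤ n · y → x ≤ᴸ [ n / 1 ]· y +ᴸ fromℕ m
IsLg⇒≤ᴸ {P} {M} m n x y (isLg p q d) P≤ M≤y = begin
  num x ^ (1 * D * 1) * ((den y ^ n) ^ 1 * 1 ^ (1 * D)) ^ root x
    ≡⟨ cong₂ (λ a e → a ^ (1 * D * 1) * ((den y ^ n) ^ 1 * 1 ^ (1 * D)) ^ e) p d ⟩
  P ^ (1 * D * 1) * ((den y ^ n) ^ 1 * 1 ^ (1 * D)) ^ 1
    ≡⟨ cong₂ (λ e f → P ^ e * f) D≡ (trans (^-identityʳ _)
         (trans (cong₂ _*_ (^-identityʳ (den y ^ n)) (^-zeroˡ (1 * D))) (*-identityʳ _))) ⟩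
  P ^ D * den y ^ n
    ≤⟨ *-monoˡ-≤ (den y ^ n) (^-monoˡ-≤ D P≤) ⟩
  (2 ^ m * M) ^ D * den y ^ n
    ≡⟨ trans (cong (_* den y ^ n) (^-distribʳ-* D (2 ^ m) M)) (*-assoc ((2 ^ m) ^ D) _ _) ⟩
  (2 ^ m) ^ D * (M ^ D * den y ^ n)
    ≤⟨ *-monoʳ-≤ ((2 ^ m) ^ D) M≤y ⟩
  (2 ^ m) ^ D * (1 ^ D * num y ^ n)
    ≡⟨ cong ((2 ^ m) ^ D *_) (trans (cong (_* num y ^ n) (^-zeroˡ D)) (*-identityˡ _)) ⟩
  (2 ^ m) ^ D * num y ^ n
    ≡⟨ *-comm ((2 ^ m) ^ D) _ ⟩
  num y ^ n * (2 ^ m) ^ D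
    ≡⟨ cong₂ _*_ (^-identityʳ (num y ^ n)) (cong ((2 ^ m) ^_) (*-identityˡ D)) ⟨
  (num y ^ n) ^ 1 * (2 ^ m) ^ (1 * D)
    ≡⟨ trans (cong₂ _*_ (^-identityʳ ((num y ^ n) ^ 1 * (2 ^ m) ^ (1 * D))) (^-zeroˡ (1 * D * 1))) (*-identityʳ _) ⟨
  ((num y ^ n) ^ 1 * (2 ^ m) ^ (1 * D)) ^ 1 * 1 ^ (1 * D * 1)
    ≡⟨ cong₂ (λ a e → ((num y ^ n) ^ 1 * (2 ^ m) ^ (1 * D)) ^ e * a ^ (1 * D * 1)) q d ⟨
  ((num y ^ n) ^ 1 * (2 ^ m) ^ (1 * D)) ^ root x * den x ^ (1 * D * 1) ∎
  where
  open ≤-Reasoning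
  D = root y
  D≡ : 1 * D * 1 ≡ D
  D≡ = trans (*-identityʳ _) (*-identityˡ D)

-- Sorted lists and cumulative counts

module _ {P : A → Set} (P? : Decidable P)
         {_≼_ : A → A → Set} (P-down : ∀ {x y} → x ≼ y → P y → P x) where

  private
    filter-above : ∀ {x xs} → ¬ P x → All (x ≼_) xs → List.length (filter P? xs) ≡ 0
    filter-above ¬px x≤xs = cong List.length
      (filter-none P? (All.map (λ x≤y py → ¬px (P-down x≤y py)) x≤xs))

  -- On a sorted list a downward closed predicate holds exactly on a prefix, whose length is that of
  -- the filtered list. The next lemma is the converse half.
  <filter⇒lookup : ∀ {xs} → AllPairs _≼_ xs → ∀ i → toℕ i < List.length (filter P? xs) → P (lookup xs i)
  <filter⇒lookup {x ∷ xs} (x≤xs ∷ xs↗) i i< with P? x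
  <filter⇒lookup (x≤xs ∷ xs↗) zero    i<       | yes px = px
  <filter⇒lookup (x≤xs ∷ xs↗) (suc i) (s≤s i<) | yes px = <filter⇒lookup xs↗ i i<
  ... | no ¬px = contradiction (subst (toℕ i <_) (filter-above ¬px x≤xs) i<) λ ()

  filter≤⇒¬lookup : ∀ {xs} → AllPairs _≼_ xs → ∀ i → List.length (filter P? xs) ≤ toℕ i → ¬ P (lookup xs i)
  filter≤⇒¬lookup {x ∷ xs} (x≤xs ∷ xs↗) i ≤i with P? x
  filter≤⇒¬lookup (x≤xs ∷ xs↗) (suc i) (s≤s ≤i) | yes px = filter≤⇒¬lookup xs↗ i ≤i
  filter≤⇒¬lookup (x≤xs ∷ xs↗) zero    _        | no ¬px = ¬px
  filter≤⇒¬lookup (x≤xs ∷ xs↗) (suc i) _        | no ¬px =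
    λ py → ¬px (P-down (All.lookup x≤xs (∈-lookup i)) py)

tabulate-≡ : ∀ {n} {f : Fin n → A} (xs : List A) → List.length xs ≡ n →
             (∀ i j → toℕ i ≡ toℕ j → f i ≡ lookup xs j) → tabulate f ≡ xs
tabulate-≡ []       refl f≡ = refl
tabulate-≡ (x ∷ xs) refl f≡ = cong₂ _∷_ (f≡ zero zero refl)
  (tabulate-≡ xs refl (λ i j i≡j → f≡ (suc i) (suc j) (cong suc i≡j)))

-- The values of `C` may be counted on the sorted list `xs`. There `C[w] ≤ i` says that entry `i` is
-- not below `w`, and `i < C[w+1]` that it is not above.
rowSymbol-ascending : ∀ (T : List⁺ (Fin σ)) {xs} → AllPairs Fin._≤_ xs → xs ↭ toList T →
                      tabulate (λ i → proj₁ (rowSymbol T i)) ≡ xs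
rowSymbol-ascending T {xs} xs↗ xs↭T = tabulate-≡ xs (↭-length xs↭T) symbol
  where
  C≡ : ∀ j → C[ T ] j ≡ List.length (filter (λ x → toℕ x <? j) xs)
  C≡ j = sym (↭-length (filter-↭ (λ x → toℕ x <? j) xs↭T))

  symbol : ∀ i j → toℕ i ≡ toℕ j → proj₁ (rowSymbol T i) ≡ lookup xs j
  symbol i j i≡j with rowSymbol T i
  ... | w , C≤i , i<C = toℕ-injective (≤-antisym
    (≮⇒≥ (filter≤⇒¬lookup (λ x → toℕ x <? toℕ w) ≤-<-trans xs↗ j (subst₂ _≤_ (C≡ (toℕ w)) i≡j C≤i)))
    (≤-pred (<filter⇒lookup (λ x → toℕ x <? suc (toℕ w)) ≤-<-trans xs↗ j
      (subst₂ _<_ i≡j (C≡ (suc (toℕ w))) i<C))))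

-- Lexicographic order

_≤ˡ_ _<ˡ_ : ∀ {n} → Vec (Fin σ) n → Vec (Fin σ) n → Set
_≤ˡ_ = Lex-≤ _≡_ Fin._≤_
_<ˡ_ = Lex-< _≡_ Fin._≤_

<ˡ⇒≱ˡ : ∀ {n} {u v : Vec (Fin σ) n} → u <ˡ v → ¬ v ≤ˡ u
<ˡ⇒≱ˡ u<v v≤u = Lex.<-irrefl (Pointwise.refl refl) (Lex.<-transˡ Fin.≤-isPartialOrder u<v v≤u)

head-mono : ∀ {n} {u v : Vec (Fin σ) (suc n)} → u ≤ˡ v → Vec.head u Fin.≤ Vec.head v
head-mono (this (x≤y , _) _) = x≤y
head-mono (next refl _)    = ≤-refl

-- For p ≥ n this says that f and g agree.

DifferFrom : ∀ {n} → ℕ → (f g : Fin n → Fin σ) → Set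
DifferFrom p f g = (∀ j → toℕ j < p → f j ≡ g j) × (∀ j → toℕ j ≡ p → f j Fin.≤ g j × f j ≢ g j)

-- Exposes the first differing position, so that the comparison can be transported to vectors of
-- another length.
≤ˡ⇒DifferFrom : ∀ {n} {u v : Vec (Fin σ) n} → u ≤ˡ v →
                u ≡ v ⊎ ∃[ p ] p < n × DifferFrom p (Vec.lookup u) (Vec.lookup v)
≤ˡ⇒DifferFrom (base _) = inj₁ refl
≤ˡ⇒DifferFrom (this x<y _) = inj₂ (0 , z<s , (λ _ ()) , λ { zero _ → x<y })
≤ˡ⇒DifferFrom (next refl u≤v) with ≤ˡ⇒DifferFrom u≤v
... | inj₁ refl = inj₁ refl
... | inj₂ (p , p<n , below , at) = inj₂ (suc p , s<s p<n
  , (λ { zero _ → refl ; (suc j) (s≤s j<p) → below j j<p })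
  , (λ { (suc j) refl → at j refl }))

DifferFrom⇒≤ˡ : ∀ {n} p {f g : Fin n → Fin σ} → DifferFrom p f g → Vec.tabulate f ≤ˡ Vec.tabulate g
DifferFrom⇒≤ˡ {n = zero}  p       _            = base tt
DifferFrom⇒≤ˡ {n = suc n} zero    (below , at) = this (at zero refl) refl
DifferFrom⇒≤ˡ {n = suc n} (suc p) (below , at) = next (below zero z<s)
  (DifferFrom⇒≤ˡ p ((λ j j<p → below (suc j) (s<s j<p)) , (λ j j≡p → at (suc j) (cong suc j≡p))))

≤ˡ-refl : ∀ {n} {u : Vec (Fin σ) n} → u ≤ˡ u
≤ˡ-refl = Lex.≤-refl (Pointwise.refl refl)

toℕ-mod : ∀ m n .{{_ : NonZero n}} → toℕ (m mod n) ≡ m % n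
toℕ-mod m n = toℕ-fromℕ< (m%n<n m n)

-- k may exceed n.

cyclicPrefix : ∀ {n} .{{_ : NonZero n}} k → Vec A n → Vec A k
cyclicPrefix {n = n} k u = Vec.tabulate (λ j → Vec.lookup u (toℕ j mod n))

-- The first difference is at some `p < n`, and up to there reduction modulo `n` changes no index.
-- If `k ≤ p` the prefixes agree; otherwise they differ first at `p`.
cyclicPrefix-mono : ∀ {n} .{{_ : NonZero n}} k {u v : Vec (Fin σ) n} →
                    u ≤ˡ v → cyclicPrefix k u ≤ˡ cyclicPrefix k v
cyclicPrefix-mono {n = n} k u≤v with ≤ˡ⇒DifferFrom u≤v
... | inj₁ refl                  = ≤ˡ-refl
... | inj₂ (p , p<n , below , at) = DifferFrom⇒≤ˡ p
  ( (λ j j<p → below (toℕ j mod n)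
      (subst (_< p) (sym (trans (toℕ-mod (toℕ j) n) (m<n⇒m%n≡m (<-trans j<p p<n)))) j<p))
  , (λ j j≡p → at (toℕ j mod n)
      (trans (toℕ-mod (toℕ j) n) (trans (m<n⇒m%n≡m (subst (_< n) (sym j≡p) p<n)) j≡p))))

-- Enumeration of the contexts

words-∷ : ∀ {k} (xs : List (Fin σ)) → AllPairs Fin._<_ xs → {ws : List (Vec (Fin σ) k)} →
          AllPairs _<ˡ_ ws → AllPairs _<ˡ_ (cartesianProductWith Vec._∷_ xs ws)
words-∷ []       []           ws↗ = []
words-∷ (x ∷ xs) (x<xs ∷ xs↗) {ws} ws↗ = AllPairs.++⁺
  (AllPairs.map⁺ (AllPairs.map (next refl) ws↗)) (words-∷ xs xs↗ ws↗)
  (All.map⁺ (All.universal (λ _ → All.cartesianProductWith⁺ (setoid _) (setoid _) Vec._∷_ xs ws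
    (λ y∈xs _ → this (<⇒≤ (All.lookup x<xs y∈xs) , Fin.<⇒≢ (All.lookup x<xs y∈xs)) refl)) ws))

-- The enumeration runs through first symbols in increasing order and through the tails within each,
-- so contexts are listed in the order in which sorted rows meet them.
words-ascending : ∀ σ k → AllPairs _<ˡ_ (words σ k)
words-ascending σ zero    = [] ∷ []
words-ascending σ (suc k) = words-∷ (allFin σ) (AllPairs.tabulate⁺-< id) (words-ascending σ k)

∈-words : ∀ {k} (w : Vec (Fin σ) k) → w ∈ words σ k
∈-words []      = here refl
∈-words (x ∷ w) = ∈-cartesianProductWith⁺ Vec._∷_ (∈-allFin x) (∈-words w)

length-cartesianProductWith : ∀ {C : Set} (f : A → B → C) xs ys →
  List.length (cartesianProductWith f xs ys) ≡ List.length xs * List.length ys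
length-cartesianProductWith f []       ys = refl
length-cartesianProductWith f (x ∷ xs) ys = trans (length-++ (map (f x) ys))
  (cong₂ _+_ (length-map (f x) ys) (length-cartesianProductWith f xs ys))

length-words : ∀ σ k → List.length (words σ k) ≡ σ ^ k
length-words σ zero    = refl
length-words σ (suc k) = trans (length-cartesianProductWith Vec._∷_ (allFin σ) (words σ k))
  (cong₂ _*_ (length-tabulate {n = σ} id) (length-words σ k))

-- Grouping a sorted list by a monotone key

module _ (_≟ᴮ_ : DecidableEquality B) (key : A → B) where

  keyed : B → List A → List A
  keyed w = filter (λ u → key u ≟ᴮ w)

  module _ {_≼_ _≺_ : B → B → Set} (≼-refl : ∀ {u} → u ≼ u) (≺⇒⋡ : ∀ {u v} → u ≺ v → ¬ v ≼ u) where

    private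
      others : B → List A → List A
      others w = filter (λ u → ¬? (key u ≟ᴮ w))

      keyed-others : ∀ {w x} → w ≢ x → ∀ L → keyed x (others w L) ≡ keyed x L
      keyed-others w≢x []      = refl
      keyed-others {w} {x} w≢x (u ∷ L) with key u ≟ᴮ w
      ... | yes key≡w = trans (keyed-others w≢x L)
        (sym (filter-reject (λ u → key u ≟ᴮ x) (λ key≡x → w≢x (trans (sym key≡w) key≡x))))
      ... | no  key≢w with key u ≟ᴮ x
      ...   | yes _ = cong (u ∷_) (keyed-others w≢x L)
      ...   | no  _ = keyed-others w≢x L

      -- The key `w` is the least one available and keys do not descend along `L`; after the first
      -- other key, `w` cannot recur.
      split : ∀ {w ws} → All (w ≺_) ws → ∀ L → AllPairs (λ u v → key u ≼ key v) L →
            All (λ u → key u ∈ w ∷ ws) L →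
              keyed w L ++ others w L ≡ L
      split w≺ws [] [] [] = refl
      split {w} w≺ws (u ∷ L) (u≼L ∷ L↗) (key∈ ∷ keys∈) with key u ≟ᴮ w
      ... | yes _     = cong (u ∷_) (split w≺ws L L↗ keys∈)
      split {w} w≺ws (u ∷ L) (u≼L ∷ L↗) (here key≡w ∷ keys∈)   | no key≢w = contradiction key≡w key≢w
      split {w} w≺ws (u ∷ L) (u≼L ∷ L↗) (there key∈ws ∷ keys∈) | no key≢w = cong₂ _++_
        (filter-none (λ u → key u ≟ᴮ w) L≢w)
        (cong (u ∷_) (filter-all (λ u → ¬? (key u ≟ᴮ w)) L≢w))
        where
        L≢w = All.map (λ { u≼v refl → ≺⇒⋡ (All.lookup w≺ws key∈ws) u≼v }) u≼L

    -- Induction on the keys: the group of the least key is split off the front, and removing it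
    -- leaves the groups of the other, distinct keys unchanged.
    concat-keyed : ∀ {ws} → AllPairs _≺_ ws → ∀ L → AllPairs (λ u v → key u ≼ key v) L →
                   All (λ u → key u ∈ ws) L →
                   concat (map (λ w → keyed w L) ws) ≡ L
    concat-keyed               []           []      []         []      = refl
    concat-keyed {ws = w ∷ ws} (w≺ws ∷ ws↗) L L↗ keys∈ = begin
      keyed w L ++ concat (map (λ x → keyed x L) ws)
        ≡⟨ cong (λ Ls → keyed w L ++ concat Ls)
             (map-cong-local (All.map (λ w≺x → keyed-others (λ { refl → ≺⇒⋡ w≺x ≼-refl }) L) w≺ws)) ⟨
      keyed w L ++ concat (map (λ x → keyed x (others w L)) ws)
        ≡⟨ cong (keyed w L ++_)
             (concat-keyed ws↗ (others w L) (AllPairs.filter⁺ (λ u → ¬? (key u ≟ᴮ w)) L↗) keys∈ws) ⟩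
      keyed w L ++ others w L
        ≡⟨ split w≺ws L L↗ keys∈ ⟩
      L ∎
      where
      open ≡-Reasoning
      keys∈ws : All (λ u → key u ∈ ws) (others w L)
      keys∈ws = All.map
        (λ { (key≢w , here key≡w) → contradiction key≡w key≢w ; (_ , there key∈ws) → key∈ws })
        (All.zip (All.all-filter (λ u → ¬? (key u ≟ᴮ w)) L , All.filter⁺ (λ u → ¬? (key u ≟ᴮ w)) keys∈))

-- Rotations and the Burrows–Wheeler transform

filter-map : ∀ {P : B → Set} (P? : Decidable P) (f : A → B) xs →
             filter P? (map f xs) ≡ map f (filter (P? ∘ f) xs)
filter-map P? f []       = refl
filter-map P? f (x ∷ xs) with P? (f x)
... | yes _ = cong (f x ∷_) (filter-map P? f xs)
... | no  _ = filter-map P? f xs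

zipWith-diagonal : ∀ {C D E : Set} (f : B → C → E) (g : D → B) (h : D → C) xs →
                   zipWith f (map g xs) (map h xs) ≡ map (λ x → f (g x) (h x)) xs
zipWith-diagonal f g h []       = refl
zipWith-diagonal f g h (x ∷ xs) = cong (f (g x) (h x) ∷_) (zipWith-diagonal f g h xs)

last-tabulate : ∀ n (f : Fin (suc n) → A) → Vec.last (Vec.tabulate f) ≡ f (Fin.fromℕ n)
last-tabulate zero    f = refl
last-tabulate (suc n) f = last-tabulate n (f ∘ suc)

applyUpTo-≡ : ∀ (f : ℕ → A) xs → (∀ i → f (toℕ i) ≡ lookup xs i) → applyUpTo f (List.length xs) ≡ xs
applyUpTo-≡ f []       f≡ = refl
applyUpTo-≡ f (x ∷ xs) f≡ = cong₂ _∷_ (f≡ zero) (applyUpTo-≡ (f ∘ suc) xs (f≡ ∘ suc))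

module _ (T : List⁺ (Fin σ)) where

  private
    m n : ℕ
    m = List.length (List⁺.tail T)
    n = suc m

    order = lex-decTotalOrder (≤-decTotalOrder σ) n

  ⟨⟩-cong-% : ∀ i j → i % n ≡ j % n → T ⟨ i ⟩ ≡ T ⟨ j ⟩
  ⟨⟩-cong-% i j i≡j = cong (lookup (toList T))
    (toℕ-injective (trans (toℕ-mod i n) (trans i≡j (sym (toℕ-mod j n)))))

  -- One step back, as `m = |T| - 1` steps forward, and then one step forward make a full turn.
  ⟨⟩-suc-+ : ∀ i → T ⟨ suc (i + m) ⟩ ≡ T ⟨ i ⟩
  ⟨⟩-suc-+ i = ⟨⟩-cong-% (suc (i + m)) i (trans (cong (_% n) (sym (+-suc i m))) ([m+n]%n≡m%n i n))

  rows : List (Vec (Fin σ) n)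
  rows = sort order (rotations T)

  rows↗ : AllPairs _≤ˡ_ rows
  rows↗ = Sorted⇒AllPairs (DecTotalOrder.totalOrder order) (sort-↗ order (rotations T))

  -- Before sorting, the rotation at `i` starts with symbol `i` of `T`, so the first column is `T`
  -- itself.
  heads↭T : map Vec.head rows ↭ toList T
  heads↭T = ↭-trans (↭-map⁺ Vec.head (sort-↭ order (rotations T))) (↭-reflexive (begin
    map Vec.head (rotations T)        ≡⟨ map-∘ (upTo n) ⟨
    map (λ i → T ⟨ i + 0 ⟩) (upTo n)  ≡⟨ map-upTo (λ i → T ⟨ i + 0 ⟩) n ⟩
    applyUpTo (λ i → T ⟨ i + 0 ⟩) n   ≡⟨ applyUpTo-≡ (λ i → T ⟨ i + 0 ⟩) (toList T) symbol ⟩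
    toList T                          ∎))
    where
    open ≡-Reasoning
    symbol : ∀ i → T ⟨ toℕ i + 0 ⟩ ≡ lookup (toList T) i
    symbol i = cong (lookup (toList T)) (toℕ-injective (begin
      toℕ ((toℕ i + 0) mod n)  ≡⟨ toℕ-mod (toℕ i + 0) n ⟩
      (toℕ i + 0) % n          ≡⟨ cong (_% n) (+-identityʳ (toℕ i)) ⟩
      toℕ i % n                ≡⟨ m<n⇒m%n≡m (toℕ<n i) ⟩
      toℕ i                    ∎))

  -- Makes the context at a position a function of the rotation alone, even when the context is
  -- longer than `T`.
  cyclicPrefix-window : ∀ k i → cyclicPrefix k (window T n i) ≡ window T k i
  cyclicPrefix-window k i = tabulate-cong (λ j → trans
    (lookup∘tabulate (λ j → T ⟨ i + toℕ j ⟩) (toℕ j mod n))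
    (⟨⟩-cong-% (i + toℕ (toℕ j mod n)) (i + toℕ j) (begin
      (i + toℕ (toℕ j mod n)) % n ≡⟨ cong (λ r → (i + r) % n) (toℕ-mod (toℕ j) n) ⟩
      (i + toℕ j % n) % n         ≡⟨ %-distribˡ-+ i (toℕ j % n) n ⟩
      (i % n + toℕ j % n % n) % n ≡⟨ cong (λ r → (i % n + r) % n) (m%n%n≡m%n (toℕ j) n) ⟩
      (i % n + toℕ j % n) % n     ≡⟨ %-distribˡ-+ i (toℕ j) n ⟨
      (i + toℕ j) % n                      ∎)))
    where open ≡-Reasoning

  rowsWith : ∀ {k} → Vec (Fin σ) k → List (Vec (Fin σ) n)
  rowsWith {k} W = keyed (≡-dec _≟_) (cyclicPrefix k) W rows

  -- Cyclic prefixes are monotone in the row, so they serve as the key by which the sorted rows fall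
  -- into contiguous groups.
  concat-rowsWith : ∀ k → concat (map rowsWith (words σ k)) ≡ rows
  concat-rowsWith k = concat-keyed (≡-dec _≟_) (cyclicPrefix k) {_≼_ = _≤ˡ_} {_≺_ = _<ˡ_} ≤ˡ-refl <ˡ⇒≱ˡ
    (words-ascending σ k) rows (AllPairs.map (cyclicPrefix-mono k) rows↗)
    (All.universal (λ u → ∈-words (cyclicPrefix k u)) rows)

  rowsWith-↭ : ∀ {k} (W : Vec (Fin σ) k) → rowsWith W ↭ map (window T n) (occurrences T W)
  rowsWith-↭ {k} W = ↭-trans (filter-↭ _ (sort-↭ order (rotations T))) (↭-reflexive (trans
    (filter-map (λ u → ≡-dec _≟_ (cyclicPrefix k u) W) (window T n) (upTo n))
    (cong (map (window T n)) (filter-≐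
      (λ i → ≡-dec _≟_ (cyclicPrefix k (window T n i)) W)
      (λ i → ≡-dec _≟_ (window T k i) W)
      ( (λ {i} → trans (sym (cyclicPrefix-window k i)))
      , (λ {i} → trans (cyclicPrefix-window k i))) (upTo n)))))

  module _ (φ : RML T) where

    rowLabel : Vec (Fin σ) n → Fin σ
    rowLabel u = label φ (Vec.last u) (Vec.head u)

    -- The first column of the sorted rows is ascending and a permutation of `T`; hence the `w′`
    -- that `rowSymbol` finds from `C` is the first symbol of the row.
    labelledBWT≡ : labelledBWT T φ ≡ map rowLabel rows
    labelledBWT≡ = trans
      (cong (zipWith (label φ) (bwt T))
        (rowSymbol-ascending T (AllPairs.map⁺ (AllPairs.map head-mono rows↗)) heads↭T))
      (zipWith-diagonal (label φ) Vec.last Vec.head rows)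

    piece : ∀ {k} → Vec (Fin σ) k → List (Fin σ)
    piece W = map rowLabel (rowsWith W)

    concat-pieces : ∀ k → concat (map piece (words σ k)) ≡ labelledBWT T φ
    concat-pieces k = begin
      concat (map piece (words σ k))
        ≡⟨ cong concat (map-∘ (words σ k)) ⟩
      concat (map (map rowLabel) (map rowsWith (words σ k)))
        ≡⟨ concat-map (map rowsWith (words σ k)) ⟩
      map rowLabel (concat (map rowsWith (words σ k)))
        ≡⟨ cong (map rowLabel) (concat-rowsWith k) ⟩
      map rowLabel rows
        ≡⟨ labelledBWT≡ ⟨
      labelledBWT T φ ∎
      where open ≡-Reasoning

    occurrence-head : ∀ {k} (W : Vec (Fin σ) (suc k)) {i} → i ∈ occurrences T W → T ⟨ i + 0 ⟩ ≡ Vec.head W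
    occurrence-head W i∈ with ∈-filter⁻ (λ i → ≡-dec _≟_ (window T _ i) W) {xs = upTo n} i∈
    ... | _ , refl = refl

    -- As the context is nonempty, all rows of the piece start with its first symbol. A single
    -- function `φ(·|w′)` therefore labels the whole piece; here positive context length is used.
    piece-↭ : ∀ {k} (W : Vec (Fin σ) (suc k)) →
              piece W ↭ map (λ w → label φ w (Vec.head W)) (preceding T W)
    piece-↭ W = ↭-trans (↭-map⁺ rowLabel (rowsWith-↭ W)) (↭-reflexive (begin
      map rowLabel (map (window T n) (occurrences T W))
        ≡⟨ map-∘ (occurrences T W) ⟨
      map (rowLabel ∘ window T n) (occurrences T W)
        ≡⟨ map-cong-local (All.tabulate (λ {i} i∈ → cong₂ (label φ) (last-window i) (occurrence-head W i∈))) ⟩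
      map (λ i → label φ (T ⟨ i + m ⟩) (Vec.head W)) (occurrences T W)
        ≡⟨ map-∘ (occurrences T W) ⟩
      map (λ w → label φ w (Vec.head W)) (preceding T W) ∎))
      where
      open ≡-Reasoning
      last-window : ∀ i → Vec.last (window T n i) ≡ T ⟨ i + m ⟩
      last-window i = trans (last-tabulate m (λ j → T ⟨ i + toℕ j ⟩)) (cong (λ j → T ⟨ i + j ⟩) (toℕ-fromℕ m))

    preceding⇒N-out : ∀ {k} (W : Vec (Fin σ) (suc k)) {w} → w ∈ preceding T W → w ∈N-out[ T ] Vec.head W
    preceding⇒N-out W w∈ with ∈-map⁻ (λ i → T ⟨ i + m ⟩) w∈
    -- The witness `i + m` is the position cyclically before `i`.
    ... | i , i∈ , w≡ = i + m , sym w≡ ,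
      trans (⟨⟩-suc-+ i) (trans (cong (T ⟨_⟩) (sym (+-identityʳ i))) (occurrence-head W i∈))

-- Huffman trees

concatMap-↭ : ∀ (f : A → List B) {xs ys} → xs ↭ ys → concatMap f xs ↭ concatMap f ys
concatMap-↭ f ↭.refl                       = ↭-refl
concatMap-↭ f (↭.prep x xs↭ys)             = ++⁺ˡ (f x) (concatMap-↭ f xs↭ys)
concatMap-↭ f (↭.swap x y xs↭ys)           =
  ↭-trans (shifts (f x) (f y)) (++⁺ˡ (f y) (++⁺ˡ (f x) (concatMap-↭ f xs↭ys)))
concatMap-↭ f (↭.trans p q)                = ↭-trans (concatMap-↭ f p) (concatMap-↭ f q)

-- A merge only regroups the leaves of the forest.
leaves-Merges : ∀ {S : List (Fin σ)} {forest t} → Merges S forest t → concatMap leaves forest ↭ leaves t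
leaves-Merges done                            = ↭-reflexive (++-identityʳ _)
leaves-Merges (merge {l = l} {r} forest↭ _ m) = ↭-trans (concatMap-↭ leaves forest↭)
  (↭-trans (↭-reflexive (sym (++-assoc (leaves l) (leaves r) _))) (leaves-Merges m))

huffman-leaves : ∀ {S : List (Fin σ)} {t} → IsHuffmanTree S t → leaves t ↭ deduplicate _≟_ S
huffman-leaves {S = S} h = ↭-sym (↭-trans (↭-reflexive (sym (trans
  (concatMap-map leaves leaf (deduplicate _≟_ S)) (concatMap-pure (deduplicate _≟_ S))))) (leaves-Merges h))

-- Bounds on the numbers of leaves and contexts

lookup-injective : ∀ {xs : List A} → Unique xs → ∀ {i j} → lookup xs i ≡ lookup xs j → i ≡ j
lookup-injective (x∉ ∷ xs!) {zero}  {zero}  _  = refl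
lookup-injective (x∉ ∷ xs!) {zero}  {suc j} eq = contradiction eq (All.lookup x∉ (∈-lookup j))
lookup-injective (x∉ ∷ xs!) {suc i} {zero}  eq = contradiction (sym eq) (All.lookup x∉ (∈-lookup i))
lookup-injective (x∉ ∷ xs!) {suc i} {suc j} eq = cong suc (lookup-injective xs! eq)

Unique⇒length≤ : ∀ {xs : List (Fin σ)} → Unique xs → List.length xs ≤ σ
Unique⇒length≤ xs! = injective⇒≤ (lookup-injective xs!)

#contexts≤ : ∀ k (T : List⁺ (Fin σ)) → #contexts k T ≤ σ ^ k
#contexts≤ {σ} k T = subst (#contexts k T ≤_) (length-words σ k)
  (length-filter (λ W → 0 <? #occurrences T W) (words σ k))

-- The entropy bound for the labelled transform

module _ (T : List⁺ (Fin σ)) (φ : RML T) (b : ℕ) .{{_ : NonZero b}} (k′ : ℕ)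
         {t : Tree (Fin σ)} (huffman : IsHuffmanTree (labelledBWT T φ) t) where

  private
    k n : ℕ
    k = suc k′
    n = length T

    S : List (Fin σ)
    S = labelledBWT T φ

    pieces : List (List (Fin σ))
    pieces = map (piece T φ) (words σ k)

    concat-pieces≡S : concat pieces ≡ S
    concat-pieces≡S = concat-pieces T φ k

    leaves! : Unique (leaves t)
    leaves! = Permutation.Unique-resp-↭ (setoid (Fin σ))
      (↭⇒↭ₛ (↭-sym (huffman-leaves huffman))) (deduplicate-! _≟_ S)

    S⊆leaves : All (_∈ leaves t) S
    S⊆leaves = All.tabulate (λ x∈S → ∈-resp-↭ (↭-sym (huffman-leaves huffman)) (∈-deduplicate⁺ _≟_ x∈S))

    piece⊆leaves : All (λ W → All (_∈ leaves t) (piece T φ W)) (words σ k)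
    piece⊆leaves = All.map⁻ (All.concat⁻ (subst (All (_∈ leaves t)) (sym concat-pieces≡S) S⊆leaves))

    length-piece : ∀ (W : Vec (Fin σ) k) → List.length (piece T φ W) ≡ #occurrences T W
    length-piece W = trans (↭-length (piece-↭ T φ W))
      (trans (length-map _ (preceding T W)) (length-map _ (occurrences T W)))

    #nonempty : List.length (filter (λ L → 0 <? List.length L) pieces) ≡ #contexts k T
    #nonempty = trans
      (cong List.length (filter-map (λ L → 0 <? List.length L) (piece T φ) (words σ k)))
      (trans (length-map (piece T φ) (filter (λ W → 0 <? List.length (piece T φ W)) (words σ k)))
        (cong List.length (filter-≐ (λ W → 0 <? List.length (piece T φ W)) (λ W → 0 <? #occurrences T W)
          ( (λ {W} → subst (0 <_) (length-piece W))
          , (λ {W} → subst (0 <_) (sym (length-piece W)))) (words σ k))))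

    -- The piece of `W` is a one-to-one relabelling of `T_W` up to order, so its multinomial
    -- coefficient is bounded by `n_W H₀(T_W)`; the weight `n_W / n` cancels against `n`.
    entropy : ∀ (W : Vec (Fin σ) k) →
              lg[ treeLayouts (piece T φ W) t / 1 ]≤ n · ([ #occurrences T W / n ]· H₀ (preceding T W))
    entropy W = lg≤-scale (#occurrences T W) n (H₀ (preceding T W))
      (subst (λ c → lg[ treeLayouts (piece T φ W) t / 1 ]≤ c · H₀ (preceding T W))
        (length-map _ (occurrences T W))
        (lg≤-H₀-layouts (preceding T W)
          (treeLayouts-relabelled (λ w → label φ w (Vec.head W)) (piece-↭ T φ W)
            (λ w₁∈ w₂∈ → injective φ (preceding⇒N-out T φ W w₁∈) (preceding⇒N-out T φ W w₂∈))
            t leaves! (All.lookup piece⊆leaves (∈-words W)))))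

    M : ℕ
    M = product (map (λ W → treeLayouts (piece T φ W) t) (words σ k))

    M≤H : lg[ M / 1 ]≤ n · H k T
    M≤H = subst (λ Q → lg[ M / Q ]≤ n · H k T) (product-map-1 (words σ k))
      (lg≤-sum n (λ W → treeLayouts (piece T φ W) t) (λ _ → 1)
        (λ W → [ #occurrences T W / n ]· H₀ (preceding T W)) (words σ k) entropy)

    internalNodes≤σ : internalNodes t ≤ σ
    internalNodes≤σ = ≤-trans (<⇒≤ (internalNodes<leaves t)) (Unique⇒length≤ leaves!)

    l : ℕ
    l = #contexts k T

    layouts≤ : hwtLayouts b S t ≤ 2 ^ (1 * (l * σ * b)) * M
    layouts≤ = begin
      hwtLayouts b S t
        ≡⟨ cong (λ S → hwtLayouts b S t) concat-pieces≡S ⟨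
      hwtLayouts b (concat pieces) t
        ≤⟨ hwtLayouts-concat b pieces t ⟩
      product (map (slack b) pieces) ^ internalNodes t * product (map (λ L → treeLayouts L t) pieces)
        ≡⟨ cong₂ (λ s p → s ^ internalNodes t * product p)
                 (trans (product-slack b pieces) (cong (λ c → 2 ^ (b * c)) #nonempty))
                 (sym (map-∘ (words σ k))) ⟩
      (2 ^ (b * l)) ^ internalNodes t * M
        ≡⟨ cong (_* M) (^-*-assoc 2 (b * l) (internalNodes t)) ⟩
      2 ^ (b * l * internalNodes t) * M
        -- The leaves are distinct symbols, so there are at most `σ` of them, and fewer internal
        -- nodes than leaves.
        ≤⟨ *-monoˡ-≤ M (^-monoʳ-≤ 2 (*-monoʳ-≤ (b * l) internalNodes≤σ)) ⟩
      2 ^ (b * l * σ) * M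
        ≡⟨ cong (λ e → 2 ^ e * M) (rearrange b l σ) ⟩
      2 ^ (1 * (l * σ * b)) * M ∎
      where
      open ≤-Reasoning
      rearrange : ∀ b l σ → b * l * σ ≡ 1 * (l * σ * b)
      rearrange = solve-∀

  hwtBits≤entropy : hwtBits b S t ≤ᴸ [ n / 1 ]· H k T +ᴸ fromℕ (1 * (#contexts k T * σ * b))
  hwtBits≤entropy = IsLg⇒≤ᴸ (1 * (l * σ * b)) n (hwtBits b S t) (H k T) (IsLg-hwtBits b S t) layouts≤ M≤H

theorem4 :
    ∃[ c ] ((G : DirectedGraph) (Ts : List⁺ (NCT G)) →
      let T = trajectoryString Ts
          σ = alphabetSize G
      in
      (φ : RML T) (b : ℕ) .{{_ : NonZero b}} (k : ℕ) → 0 < k →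
      (t : Tree (Fin σ)) → IsHuffmanTree (labelledBWT T φ) t →
      let l = #contexts k T in
      l ≤ σ ^ k ×
      hwtBits b (labelledBWT T φ) t ≤ᴸ [ length T / 1 ]· H k T +ᴸ fromℕ (c * (l * σ * b)))
-- The constant is 1: each of the `l` nonempty pieces is charged `b` bits at each of at most `σ`
-- internal nodes.
theorem4 = 1 , λ { G Ts φ b (suc k) _ t huffman →
  #contexts≤ (suc k) (trajectoryString Ts) , hwtBits≤entropy (trajectoryString Ts) φ b k huffman }
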